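{- Let $\varphi,\psi$ be modal formulas, $\sigma=\textit{sig}(\varphi)\cup\textit{sig}(\psi)$ and $\varrho=\textit{sig}(\varphi)\cap\textit{sig}(\psi)$. Then $\varphi\to\psi$ does not have an interpolant in $\mathsf{wK4}$ if and only if there exist $\sigma$-models $\mathfrak M_\varphi$ and $\mathfrak M_\psi$ based on weakly transitive frames, with roots $r_\varphi$ and $r_\psi$ respectively, such that $\mathfrak M_\varphi,r_\varphi\models\varphi$, $\mathfrak M_\psi,r_\psi\models\neg\psi$, $\mathfrak M_\varphi,r_\varphi\sim^\varrho\mathfrak M_\psi,r_\psi$, and both models have size triple-exponential in $|\varphi|$ and $|\psi|$ (namely $\mathcal O\bigl(2^{2^{2^{|\textit{sub}(\varphi)\cup\textit{sub}(\psi)|}}}\bigr)$ points).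
   Context: Formulas are built from propositional variables, $\bot,\top$, $\land$, $\neg$ and $\Diamond$. $\textit{sig}(\chi)$ is the (finite) set of variables of $\chi$; $\textit{sub}(\chi)$ is the set of subformulas of $\chi$ together with their negations, $|\chi|=|\textit{sub}(\chi)|$. $\mathsf{wK4}$ is the normal modal logic $\mathsf{K}\oplus\Diamond\Diamond p\to(p\lor\Diamond p)$, characterised by weakly transitive Kripke frames $(W,R)$: $xRyRz$ implies $x=z$ or $xRz$. A $\sigma$-model is a frame with a valuation of the variables of $\sigma$. A root $r$ of a frame is a point from which every point is $r$ or reachable via a finite $R$-path. For $\varrho\subseteq\sigma$, a $\varrho$-bisimulation between models on frames $(W_1,R_1)$, $(W_2,R_2)$ is $\boldsymbol\beta\subseteq W_1\times W_2$ such that if $x_1\boldsymbol\beta x_2$ then $x_1,x_2$ satisfy the same variables of $\varrho$, every $R_1$-successor of $x_1$ is $\boldsymbol\beta$-related to some $R_2$-successor of $x_2$, and vice versa; $\mathfrak M_1,z_1\sim^\varrho\mathfrak M_2,z_2$ means some $\varrho$-bisimulation relates $z_1,z_2$. An interpolant for $\varphi\to\psi$ in $L$ is a formula $\iota$ with $\textit{sig}(\iota)\subseteq\textit{sig}(\varphi)\cap\textit{sig}(\psi)$ (built from $\top,\bot$ if this intersection is empty) such that $\varphi\to\iota\in L$ and $\iota\to\psi\in L$. -}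

module Defs where

open import Data.Nat using (ℕ; _≤_; _*_; _^_)
import Data.Nat as ℕ
open import Data.Bool using (Bool; true; false; _∧_; not)
open import Data.Fin using (Fin)
open import Data.List using (List; []; _∷_; _++_; length; deduplicate)
open import Data.List.Membership.Propositional using (_∈_)
open import Data.Product using (Σ; _×_; _,_; ∃; ∃-syntax)
open import Data.Sum using (_⊎_)
open import Data.Empty using (⊥)
open import Data.Unit using (⊤)
open import Relation.Nullary using (¬_; yes; no)
open import Relation.Binary.Definitions using (DecidableEquality)
open import Relation.Binary.PropositionalEquality using (_≡_; refl; cong; cong₂)
open import Relation.Binary.Construct.Closure.ReflexiveTransitive using (Star)

data Fm : Set where
  var  : ℕ → Fm
  fls  : Fm
  tru  : Fm
  _∧'_ : Fm → Fm → Fm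
  ¬'_  : Fm → Fm
  ◇_   : Fm → Fm

infixr 6 _∧'_
infixr 4 _∨'_
infixr 3 _⇒_
infix 2 _⇔'_
infix 7 ¬'_ ◇_ □_

_⇒_ : Fm → Fm → Fm
φ ⇒ ψ = ¬' (φ ∧' ¬' ψ)

_∨'_ : Fm → Fm → Fm
φ ∨' ψ = ¬' (¬' φ ∧' ¬' ψ)

_⇔'_ : Fm → Fm → Fm
φ ⇔' ψ = (φ ⇒ ψ) ∧' (ψ ⇒ φ)

□_ : Fm → Fm
□ φ = ¬' ◇ ¬' φ

private
  var-inj : ∀ {m n} → var m ≡ var n → m ≡ n
  var-inj refl = refl
  ∧-inj₁ : ∀ {a b c d} → (a ∧' b) ≡ (c ∧' d) → a ≡ c
  ∧-inj₁ refl = refl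
  ∧-inj₂ : ∀ {a b c d} → (a ∧' b) ≡ (c ∧' d) → b ≡ d
  ∧-inj₂ refl = refl
  ¬-inj : ∀ {a b} → ¬' a ≡ ¬' b → a ≡ b
  ¬-inj refl = refl
  ◇-inj : ∀ {a b} → ◇ a ≡ ◇ b → a ≡ b
  ◇-inj refl = refl

_≟Fm_ : DecidableEquality Fm
var m ≟Fm var n with m ℕ.≟ n
... | yes refl = yes refl
... | no ne = no (λ e → ne (var-inj e))
var _ ≟Fm fls = no λ ()
var _ ≟Fm tru = no λ ()
var _ ≟Fm (_ ∧' _) = no λ ()
var _ ≟Fm (¬' _) = no λ ()
var _ ≟Fm (◇ _) = no λ ()
fls ≟Fm var _ = no λ ()
fls ≟Fm fls = yes refl
fls ≟Fm tru = no λ ()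
fls ≟Fm (_ ∧' _) = no λ ()
fls ≟Fm (¬' _) = no λ ()
fls ≟Fm (◇ _) = no λ ()
tru ≟Fm var _ = no λ ()
tru ≟Fm fls = no λ ()
tru ≟Fm tru = yes refl
tru ≟Fm (_ ∧' _) = no λ ()
tru ≟Fm (¬' _) = no λ ()
tru ≟Fm (◇ _) = no λ ()
(_ ∧' _) ≟Fm var _ = no λ ()
(_ ∧' _) ≟Fm fls = no λ ()
(_ ∧' _) ≟Fm tru = no λ ()
(a ∧' b) ≟Fm (c ∧' d) with a ≟Fm c | b ≟Fm d
... | yes refl | yes refl = yes refl
... | no ne | _ = no (λ e → ne (∧-inj₁ e))
... | yes _ | no ne = no (λ e → ne (∧-inj₂ e))
(_ ∧' _) ≟Fm (¬' _) = no λ ()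
(_ ∧' _) ≟Fm (◇ _) = no λ ()
(¬' _) ≟Fm var _ = no λ ()
(¬' _) ≟Fm fls = no λ ()
(¬' _) ≟Fm tru = no λ ()
(¬' _) ≟Fm (_ ∧' _) = no λ ()
(¬' a) ≟Fm (¬' b) with a ≟Fm b
... | yes refl = yes refl
... | no ne = no (λ e → ne (¬-inj e))
(¬' _) ≟Fm (◇ _) = no λ ()
(◇ _) ≟Fm var _ = no λ ()
(◇ _) ≟Fm fls = no λ ()
(◇ _) ≟Fm tru = no λ ()
(◇ _) ≟Fm (_ ∧' _) = no λ ()
(◇ _) ≟Fm (¬' _) = no λ ()
(◇ a) ≟Fm (◇ b) with a ≟Fm b
... | yes refl = yes refl
... | no ne = no (λ e → ne (◇-inj e))

sig : Fm → List ℕ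
sig (var p)  = p ∷ []
sig fls      = []
sig tru      = []
sig (a ∧' b) = sig a ++ sig b
sig (¬' a)   = sig a
sig (◇ a)    = sig a

subf : Fm → List Fm
subf (var p)  = var p ∷ []
subf fls      = fls ∷ []
subf tru      = tru ∷ []
subf (a ∧' b) = (a ∧' b) ∷ subf a ++ subf b
subf (¬' a)   = ¬' a ∷ subf a
subf (◇ a)    = ◇ a ∷ subf a

negs : List Fm → List Fm
negs []       = []
negs (x ∷ xs) = ¬' x ∷ negs xs

sub : Fm → List Fm
sub χ = subf χ ++ negs (subf χ)

∣sub∪sub∣ : Fm → Fm → ℕ
∣sub∪sub∣ φ ψ = length (deduplicate _≟Fm_ (sub φ ++ sub ψ))

peval : (Fm → Bool) → Fm → Bool
peval v (var p)  = v (var p)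
peval v fls      = false
peval v tru      = true
peval v (a ∧' b) = peval v a ∧ peval v b
peval v (¬' a)   = not (peval v a)
peval v (◇ a)    = v (◇ a)

-- substitution instances of propositional tautologies
Taut : Fm → Set
Taut φ = ∀ (v : Fm → Bool) → peval v φ ≡ true

data wK4⊢_ : Fm → Set where
  taut : ∀ {φ} → Taut φ → wK4⊢ φ
  axK  : ∀ φ ψ → wK4⊢ (□ (φ ⇒ ψ) ⇒ (□ φ ⇒ □ ψ))
  axDual : ∀ φ → wK4⊢ (◇ φ ⇔' ¬' □ ¬' φ)
  axW  : ∀ φ → wK4⊢ (◇ ◇ φ ⇒ (φ ∨' ◇ φ))
  mp   : ∀ {φ ψ} → wK4⊢ (φ ⇒ ψ) → wK4⊢ φ → wK4⊢ ψ
  nec  : ∀ {φ} → wK4⊢ φ → wK4⊢ (□ φ)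

IsInterpolant : Fm → Fm → Fm → Set
IsInterpolant φ ψ ι =
  (∀ {p} → p ∈ sig ι → (p ∈ sig φ) × (p ∈ sig ψ)) ×
  wK4⊢ (φ ⇒ ι) × wK4⊢ (ι ⇒ ψ)

HasInterpolant : Fm → Fm → Set
HasInterpolant φ ψ = ∃[ ι ] IsInterpolant φ ψ ι

record Model (n : ℕ) : Set where
  field
    R : Fin n → Fin n → Bool
    V : ℕ → Fin n → Bool
open Model public

_R⟨_⟩_ : ∀ {n} → Fin n → Model n → Fin n → Set
x R⟨ M ⟩ y = R M x y ≡ true

WeaklyTransitive : ∀ {n} → Model n → Set
WeaklyTransitive M = ∀ x y z → x R⟨ M ⟩ y → y R⟨ M ⟩ z → x ≡ z ⊎ x R⟨ M ⟩ z

IsRoot : ∀ {n} → Model n → Fin n → Set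
IsRoot M r = ∀ x → Star (λ a b → a R⟨ M ⟩ b) r x

infix 1 _∣_⊨_
_∣_⊨_ : ∀ {n} → Model n → Fin n → Fm → Set
M ∣ w ⊨ var p   = V M p w ≡ true
M ∣ w ⊨ fls     = ⊥
M ∣ w ⊨ tru     = ⊤
M ∣ w ⊨ (a ∧' b) = (M ∣ w ⊨ a) × (M ∣ w ⊨ b)
M ∣ w ⊨ (¬' a)  = ¬ (M ∣ w ⊨ a)
M ∣ w ⊨ (◇ a)   = ∃[ v ] (w R⟨ M ⟩ v × (M ∣ v ⊨ a))

IsBisim : ∀ {n₁ n₂} → List ℕ → Model n₁ → Model n₂ → (Fin n₁ → Fin n₂ → Set) → Set
IsBisim ϱ M₁ M₂ β =
  ∀ x₁ x₂ → β x₁ x₂ →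
    (∀ {p} → p ∈ ϱ → V M₁ p x₁ ≡ V M₂ p x₂) ×
    (∀ y₁ → x₁ R⟨ M₁ ⟩ y₁ → ∃[ y₂ ] (x₂ R⟨ M₂ ⟩ y₂ × β y₁ y₂)) ×
    (∀ y₂ → x₂ R⟨ M₂ ⟩ y₂ → ∃[ y₁ ] (x₁ R⟨ M₁ ⟩ y₁ × β y₁ y₂))

Bisimilar : ∀ {n₁ n₂} → List ℕ → Model n₁ → Fin n₁ → Model n₂ → Fin n₂ → Set₁
Bisimilar ϱ M₁ z₁ M₂ z₂ = ∃[ β ] (IsBisim ϱ M₁ M₂ β × β z₁ z₂)

_∩sig_ : Fm → Fm → List ℕ
φ ∩sig ψ = Data.List.filter (λ p → Data.List.Membership.DecPropositional._∈?_ ℕ._≟_ p (sig ψ)) (sig φ)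
  where import Data.List ; import Data.List.Membership.DecPropositional

Witness : ℕ → Fm → Fm → Set₁
Witness bound φ ψ =
  Σ ℕ λ n₁ → Σ ℕ λ n₂ → Σ (Model n₁) λ M₁ → Σ (Model n₂) λ M₂ →
  Σ (Fin n₁) λ r₁ → Σ (Fin n₂) λ r₂ →
    WeaklyTransitive M₁ × WeaklyTransitive M₂ ×
    IsRoot M₁ r₁ × IsRoot M₂ r₂ ×
    (M₁ ∣ r₁ ⊨ φ) × (M₂ ∣ r₂ ⊨ ¬' ψ) ×
    Bisimilar (φ ∩sig ψ) M₁ r₁ M₂ r₂ ×
    n₁ ≤ bound × n₂ ≤ bound

tripleExp : ℕ → ℕ
tripleExp k = 2 ^ (2 ^ (2 ^ k))

{-# OPTIONS --safe #-}

-- All points are taken from a single canonical model of wK4; x ~ y means that x and y contain the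
-- same formulas over the common variables.  Then ~ is a bisimulation of that model with itself, and
-- if there is no interpolant some x ∋ φ and y ∋ ¬ψ satisfy x ~ y.  It remains to shrink the model.
-- The type of a point is its trace on L = sub φ ∪ sub ψ and its label is the set of types realised
-- by its ~-class.  For every label X one representative ρ X is chosen; the kernel of X consists of
-- the points that are mutually reachable with ρ X up to ~.  For every label Z and type s occurring
-- in the kernel one point κ (X , Z , s) is chosen.  A point of the finite model consists of some
-- κ (X , Z₀ , s₀) and the label and type of some point in its cluster; points with the same X and the
-- same label are bisimilar.  Say that C dominates C' if a or ◇ a somewhere in C' implies ◇ a
-- everywhere in C, for ◇ a ∈ L.  Within one kernel a cluster C sees the clusters it dominates, unless
-- C meets a label that is irreflexive in the kernel: then C is maximal there.  Clusters over X see the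
-- clusters over Y that they dominate, provided that every cluster over X dominates some cluster over
-- Y.  This relation is weakly transitive and there are only doubly exponentially many points.
-- Choosing representatives is classical, so the construction is carried out under ¬¬; this suffices
-- because the existence of such a model on a fixed finite set of points is decidable.
module Submission where

open import Defs
open import Level using (Level)
open import Data.Bool using (Bool; true; false; _∧_; not; if_then_else_)
open import Data.Bool.Properties using () renaming (_≟_ to _≟ᵇ_)
open import Data.Empty using (⊥; ⊥-elim)
open import Data.Fin as Fin using (Fin; zero; suc; finToFun; funToFin)
import Data.Fin.Properties as Finₚ
open import Data.List as List
  using (List; []; _∷_; _++_; map; length; cartesianProductWith; deduplicate)
import Data.Nat
open import Data.List.Membership.DecPropositional Data.Nat._≟_ using (_∈?_)
open import Data.List.Membership.Propositional using (_∈_)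
open import Data.List.Membership.Propositional.Properties
  using (∈-++⁺ˡ; ∈-++⁺ʳ; ∈-++⁻; ∈-map⁺; ∈-cartesianProductWith⁺; ∈-filter⁺; ∈-filter⁻;
         ∈-deduplicate⁺; ∈-deduplicate⁻)
open import Data.List.Relation.Unary.All as All using ()
open import Data.List.Relation.Unary.Any as Any using (here; there)
open import Data.List.Relation.Unary.Any.Properties using (lookup-index)
open import Data.Nat
  using (ℕ; zero; suc; _+_; _*_; _^_; _⊔_; _≤_; _≤′_; ≤′-refl; ≤′-step; z≤n; s≤s)
open import Data.Nat.Properties
  using (m≤m⊔n; m≤n⊔m; ≤⇒≤′; ≤-refl; ≤-trans; m≤n⇒m≤1+n; +-suc; +-comm; +-assoc; +-identityʳ;
         +-mono-≤; +-monoʳ-≤; *-suc; ^-monoʳ-≤; ^-distribˡ-+-*; module ≤-Reasoning)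
open import Data.Nat.Tactic.RingSolver using (solve-∀)
open import Data.Product using (Σ; ∃-syntax; _×_; _,_; proj₁; proj₂)
open import Data.Product.Function.NonDependent.Propositional using (_×-↔_)
open import Data.Product.Properties using (≡-dec)
open import Data.Sum using (_⊎_; inj₁; inj₂; [_,_]′)
open import Data.Unit using (tt)
open import Data.Vec using (Vec; []; _∷_; lookup) renaming (map to vmap)
open import Data.Vec.Properties using (lookup-map)
open import Function using (_∘_; id; _|>_)
open import Function.Bundles using (_↔_; Inverse; _⇔_; mk⇔)
open import Function.Properties.Inverse using (↔-refl; ↔-trans)
open import Relation.Binary.Construct.Closure.ReflexiveTransitive using (Star; ε; _◅_)
open import Relation.Binary.PropositionalEquality
  using (_≡_; _≢_; refl; sym; trans; cong; cong₂; subst)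
open import Relation.Nullary using (¬_; Dec; yes; no; does; ¬¬-excluded-middle; contradiction)
open import Relation.Nullary.Decidable
  using (decidable-stable; dec-true; does-⇔; map′; ¬?; _×-dec_; _→-dec_; _⊎-dec_)

private variable
  ℓ ℓ′ : Level

-- Reasoning under double negation

_>>=_ : {A : Set ℓ} {B : Set ℓ′} → ¬ ¬ A → (A → ¬ ¬ B) → ¬ ¬ B
(m >>= f) k = m λ a → f a k

return : {A : Set ℓ} → A → ¬ ¬ A
return a k = k a

-- Soundness and invariance under bisimulation

⊨-dec : ∀ {n} (M : Model n) w a → Dec (M ∣ w ⊨ a)
⊨-dec M w (var p) = V M p w ≟ᵇ true
⊨-dec M w fls = no λ ()
⊨-dec M w tru = yes tt
⊨-dec M w (a ∧' b) = ⊨-dec M w a ×-dec ⊨-dec M w b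
⊨-dec M w (¬' a) = ¬? (⊨-dec M w a)
⊨-dec M w (◇ a) = Finₚ.any? λ v → (R M w v ≟ᵇ true) ×-dec ⊨-dec M v a

⊨-⇒ : ∀ {n} (M : Model n) w a b → M ∣ w ⊨ (a ⇒ b) → M ∣ w ⊨ a → M ∣ w ⊨ b
⊨-⇒ M w a b h p with ⊨-dec M w b
... | yes q = q
... | no ¬q = ⊥-elim (h (p , ¬q))

-- A formula `◇ a` counts as an atom for `peval`, so truth at a point is one of the valuations over
-- which `Taut` quantifies.
peval-does : ∀ {n} (M : Model n) w a → peval (λ c → does (⊨-dec M w c)) a ≡ does (⊨-dec M w a)
peval-does M w (var p) = refl
peval-does M w fls = refl
peval-does M w tru = refl
peval-does M w (a ∧' b) = cong₂ _∧_ (peval-does M w a) (peval-does M w b)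
peval-does M w (¬' a) = cong not (peval-does M w a)
peval-does M w (◇ a) = refl

does-true : {P : Set ℓ} (d : Dec P) → does d ≡ true → P
does-true (yes p) _ = p

soundness : ∀ {n} (M : Model n) → WeaklyTransitive M → ∀ {a} → wK4⊢ a → ∀ w → M ∣ w ⊨ a
soundness M wt {a} (taut t) w = does-true (⊨-dec M w a) (trans (sym (peval-does M w a)) (t _))
soundness M wt (axK φ ψ) w (k , h) = h λ (□φ , ¬□ψ) → ¬□ψ λ (v , r , ¬ψ) →
  □φ (v , r , λ p → k (v , r , λ imp → imp (p , ¬ψ)))
soundness M wt (axDual φ) w =
  (λ ((v , r , p) , h) → h λ □¬φ → □¬φ (v , r , λ ¬φ → ¬φ p)) ,
  (λ (h , ¬◇φ) → h λ (v , r , ¬¬φ) → ¬¬φ λ p → ¬◇φ (v , r , p))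
soundness M wt (axW φ) w ((v , r , u , s , p) , h) = h λ (¬p , ¬◇p) →
  [ (λ { refl → ¬p p }) , (λ r' → ¬◇p (u , r' , p)) ]′ (wt w v u r s)
soundness M wt (mp {φ} {ψ} d e) w = ⊨-⇒ M w φ ψ (soundness M wt d w) (soundness M wt e w)
soundness M wt (nec d) w (v , r , ¬a) = ¬a (soundness M wt d v)

bisim-invariant : ∀ {n₁ n₂} (ϱ : List ℕ) (M₁ : Model n₁) (M₂ : Model n₂) β → IsBisim ϱ M₁ M₂ β →
  ∀ a → (∀ {p} → p ∈ sig a → p ∈ ϱ) → ∀ {x₁ x₂} → β x₁ x₂ →
  (M₁ ∣ x₁ ⊨ a → M₂ ∣ x₂ ⊨ a) × (M₂ ∣ x₂ ⊨ a → M₁ ∣ x₁ ⊨ a)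
bisim-invariant ϱ M₁ M₂ β bis (var p) ⊆ϱ b =
  let eq = proj₁ (bis _ _ b) (⊆ϱ (here refl)) in trans (sym eq) , trans eq
bisim-invariant ϱ M₁ M₂ β bis fls ⊆ϱ b = id , id
bisim-invariant ϱ M₁ M₂ β bis tru ⊆ϱ b = id , id
bisim-invariant ϱ M₁ M₂ β bis (a ∧' c) ⊆ϱ b =
  let (f , g) = bisim-invariant ϱ M₁ M₂ β bis a (⊆ϱ ∘ ∈-++⁺ˡ) b
      (f' , g') = bisim-invariant ϱ M₁ M₂ β bis c (⊆ϱ ∘ ∈-++⁺ʳ (sig a)) b
  in (λ (p , q) → f p , f' q) , (λ (p , q) → g p , g' q)
bisim-invariant ϱ M₁ M₂ β bis (¬' a) ⊆ϱ b =
  let (f , g) = bisim-invariant ϱ M₁ M₂ β bis a ⊆ϱ b in (λ h → h ∘ g) , (λ h → h ∘ f)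
bisim-invariant ϱ M₁ M₂ β bis (◇ a) ⊆ϱ b =
  let (_ , forth , back) = bis _ _ b in
  (λ (y , r , p) → let (y' , r' , b') = forth y r in
     y' , r' , proj₁ (bisim-invariant ϱ M₁ M₂ β bis a ⊆ϱ b') p) ,
  (λ (y , r , p) → let (y' , r' , b') = back y r in
     y' , r' , proj₂ (bisim-invariant ϱ M₁ M₂ β bis a ⊆ϱ b') p)

-- An interpolant would be true at `r₁`, by invariance also at `r₂`, and would force `ψ` there.
witness⇒¬interpolant : ∀ {b φ ψ} → Witness b φ ψ → ¬ HasInterpolant φ ψ
witness⇒¬interpolant {φ = φ} {ψ}
  (_ , _ , M₁ , M₂ , r₁ , r₂ , wt₁ , wt₂ , _ , _ , r₁⊨φ , r₂⊨¬ψ , (β , bis , br) , _ , _)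
  (ι , sigι , φ⇒ι , ι⇒ψ) =
  r₂⊨¬ψ (⊨-⇒ M₂ r₂ ι ψ (soundness M₂ wt₂ ι⇒ψ r₂)
    (proj₁ (bisim-invariant (φ ∩sig ψ) M₁ M₂ β bis ι
       (λ p∈ → ∈-filter⁺ (_∈? sig ψ) (proj₁ (sigι p∈)) (proj₂ (sigι p∈))) br)
      (⊨-⇒ M₁ r₁ φ ι (soundness M₁ wt₁ φ⇒ι r₁) r₁⊨φ)))

-- Derivations

infixr 3 _⊃_
infixr 6 _&_
-- Reflected propositional formulas whose letters stand for arbitrary modal formulas. A derivation
-- by `taut` then amounts to a truth table that is checked by computation.
data Schema (n : ℕ) : Set where
  #_  : Fin n → Schema n
  ff : Schema n
  _&_ : Schema n → Schema n → Schema n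
  ∼_  : Schema n → Schema n
infix 7 ∼_ #_

_⊃_ : ∀ {n} → Schema n → Schema n → Schema n
s ⊃ t = ∼ (s & ∼ t)

inst : ∀ {n} → Vec Fm n → Schema n → Fm
inst θ (# i) = lookup θ i
inst θ ff = fls
inst θ (s & t) = inst θ s ∧' inst θ t
inst θ (∼ s) = ¬' inst θ s

eval : ∀ {n} → Vec Bool n → Schema n → Bool
eval v (# i) = lookup v i
eval v ff = false
eval v (s & t) = eval v s ∧ eval v t
eval v (∼ s) = not (eval v s)

allValuations : ∀ n → (Vec Bool n → Bool) → Bool
allValuations zero f = f []
allValuations (suc n) f = allValuations n (f ∘ (true ∷_)) ∧ allValuations n (f ∘ (false ∷_))

∧-true : ∀ {x y} → x ∧ y ≡ true → x ≡ true × y ≡ true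
∧-true {true} {true} refl = refl , refl

allValuations-sound : ∀ n f → allValuations n f ≡ true → ∀ v → f v ≡ true
allValuations-sound zero f h [] = h
allValuations-sound (suc n) f h (true ∷ v) = allValuations-sound n _ (proj₁ (∧-true h)) v
allValuations-sound (suc n) f h (false ∷ v) = allValuations-sound n _ (proj₂ (∧-true h)) v

peval-inst : ∀ {n} (v : Fm → Bool) (θ : Vec Fm n) s → peval v (inst θ s) ≡ eval (vmap (peval v) θ) s
peval-inst v θ (# i) = sym (lookup-map i (peval v) θ)
peval-inst v θ ff = refl
peval-inst v θ (s & t) = cong₂ _∧_ (peval-inst v θ s) (peval-inst v θ t)
peval-inst v θ (∼ s) = cong not (peval-inst v θ s)

tautology : ∀ {n} (s : Schema n) {_ : allValuations n (λ v → eval v s) ≡ true} (θ : Vec Fm n) →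
  wK4⊢ (inst θ s)
tautology s {h} θ = taut λ v →
  trans (peval-inst v θ s) (allValuations-sound _ (λ u → eval u s) h (vmap (peval v) θ))

pattern x₀ = # zero
pattern x₁ = # (suc zero)
pattern x₂ = # (suc (suc zero))
pattern x₃ = # (suc (suc (suc zero)))
pattern x₄ = # (suc (suc (suc (suc zero))))

⇒-refl : ∀ a → wK4⊢ (a ⇒ a)
⇒-refl a = tautology (x₀ ⊃ x₀) {refl} (a ∷ [])

⊢-tru : wK4⊢ tru
⊢-tru = taut λ _ → refl

⇒-const : ∀ {a b} → wK4⊢ b → wK4⊢ (a ⇒ b)
⇒-const {a} {b} = mp (tautology (x₀ ⊃ x₁ ⊃ x₀) {refl} (b ∷ a ∷ []))

⇒-∧ : ∀ {a b c} → wK4⊢ (a ⇒ b) → wK4⊢ (a ⇒ c) → wK4⊢ (a ⇒ b ∧' c)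
⇒-∧ {a} {b} {c} p q =
  mp (mp (tautology ((x₀ ⊃ x₁) ⊃ (x₀ ⊃ x₂) ⊃ x₀ ⊃ (x₁ & x₂)) {refl} (a ∷ b ∷ c ∷ [])) p) q

contraposition : ∀ {a b} → wK4⊢ (a ⇒ b) → wK4⊢ (¬' b ⇒ ¬' a)
contraposition {a} {b} = mp (tautology ((x₀ ⊃ x₁) ⊃ (∼ x₁ ⊃ ∼ x₀)) {refl} (a ∷ b ∷ []))

□-mono : ∀ {a b} → wK4⊢ (a ⇒ b) → wK4⊢ (□ a ⇒ □ b)
□-mono d = mp (axK _ _) (nec d)

-- Since `□` unfolds to `¬' ◇ ¬'`, contraposition alone would only reach `◇ ¬' ¬' a`; `axDual`
-- removes the double negation under the diamond.
◇-mono : ∀ {a b} → wK4⊢ (a ⇒ b) → wK4⊢ (◇ a ⇒ ◇ b)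
◇-mono {a} {b} d = mp (mp (mp
  (tautology (((x₀ ⊃ ∼ x₁) & (∼ x₁ ⊃ x₀)) ⊃ ((x₂ ⊃ ∼ x₃) & (∼ x₃ ⊃ x₂)) ⊃ (x₃ ⊃ x₁) ⊃ (x₀ ⊃ x₂)) {refl}
    (◇ a ∷ □ ¬' a ∷ ◇ b ∷ □ ¬' b ∷ []))
  (axDual a)) (axDual b)) (□-mono (contraposition d))

-- The canonical model

-- Closure is under detachment only, not under `nec`: theories model local consequence.
record Theory : Set₁ where
  field
    mem : Fm → Set
    thm : ∀ {a} → wK4⊢ a → mem a
    mpT : ∀ {a b} → mem (a ⇒ b) → mem a → mem b

open Theory

Consistent : Theory → Set
Consistent T = ¬ mem T fls

-- The condition for adding `a` sits inside the membership predicate, so the theory is defined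
-- without deciding whether `¬' a` belongs to `T`.
extend : Theory → Fm → Theory
extend T a = record
  { mem = λ b → mem T b ⊎ (¬ mem T (¬' a) × mem T (a ⇒ b))
  ; thm = inj₁ ∘ thm T
  ; mpT = λ
    { (inj₁ f) (inj₁ b) → inj₁ (mpT T f b)
    ; (inj₁ f) (inj₂ (n , b)) → inj₂ (n , S (weaken f) b)
    ; (inj₂ (n , f)) (inj₁ b) → inj₂ (n , S f (weaken b))
    ; (inj₂ (n , f)) (inj₂ (_ , b)) → inj₂ (n , S f b) } }
  where
  weaken : ∀ {b} → mem T b → mem T (a ⇒ b)
  weaken {b} = mpT T (thm T (tautology (x₀ ⊃ x₁ ⊃ x₀) {refl} (b ∷ a ∷ [])))
  S : ∀ {b c} → mem T (a ⇒ b ⇒ c) → mem T (a ⇒ b) → mem T (a ⇒ c)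
  S {b} {c} f g = mpT T (mpT T (thm T
    (tautology ((x₀ ⊃ x₁ ⊃ x₂) ⊃ (x₀ ⊃ x₁) ⊃ x₀ ⊃ x₂) {refl} (a ∷ b ∷ c ∷ []))) f) g

extendAll : Theory → List Fm → Theory
extendAll T [] = T
extendAll T (a ∷ as) = extendAll (extend T a) as

extendAll-⊇ : ∀ T as {b} → mem T b → mem (extendAll T as) b
extendAll-⊇ T [] h = h
extendAll-⊇ T (a ∷ as) h = extendAll-⊇ (extend T a) as (inj₁ h)

extend-consistent : ∀ T a → Consistent T → Consistent (extend T a)
extend-consistent T a c (inj₁ h) = c h
extend-consistent T a c (inj₂ (n , h)) =
  n (mpT T (thm T (tautology ((x₀ ⊃ ff) ⊃ ∼ x₀) {refl} (a ∷ []))) h)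

extendAll-consistent : ∀ T as → Consistent T → Consistent (extendAll T as)
extendAll-consistent T [] c = c
extendAll-consistent T (a ∷ as) c = extendAll-consistent (extend T a) as (extend-consistent T a c)

extendAll-decides : ∀ T as {a} → a ∈ as →
  ¬ ¬ (mem (extendAll T as) a ⊎ mem (extendAll T as) (¬' a))
extendAll-decides T (a ∷ as) (here refl) = ¬¬-excluded-middle >>= λ
  { (yes h) → return (inj₂ (extendAll-⊇ (extend T a) as (inj₁ h)))
  ; (no n) → return (inj₁ (extendAll-⊇ (extend T a) as (inj₂ (n , thm T (⇒-refl a))))) }
extendAll-decides T (a ∷ as) (there i) = extendAll-decides (extend T a) as i

formulas : ℕ → List Fm
formulas zero = []
formulas (suc n) = var n ∷ fls ∷ tru ∷ formulas n ++ map ¬'_ (formulas n) ++ map ◇_ (formulas n)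
  ++ cartesianProductWith _∧'_ (formulas n) (formulas n)

formulas-suc : ∀ {n a} → a ∈ formulas n → a ∈ formulas (suc n)
formulas-suc i = there (there (there (∈-++⁺ˡ i)))

formulas-mono : ∀ {m n a} → m ≤′ n → a ∈ formulas m → a ∈ formulas n
formulas-mono ≤′-refl i = i
formulas-mono (≤′-step p) i = formulas-suc (formulas-mono p i)

∈-formulas : ∀ a → ∃[ n ] (a ∈ formulas n)
∈-formulas (var p) = suc p , here refl
∈-formulas fls = 1 , there (here refl)
∈-formulas tru = 1 , there (there (here refl))
∈-formulas (a ∧' b) =
  let (m , i) = ∈-formulas a
      (n , j) = ∈-formulas b
      k = m ⊔ n
  in suc k , there (there (there (∈-++⁺ʳ (formulas k) (∈-++⁺ʳ (map ¬'_ (formulas k))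
       (∈-++⁺ʳ (map ◇_ (formulas k)) (∈-cartesianProductWith⁺ _∧'_
         (formulas-mono (≤⇒≤′ (m≤m⊔n m n)) i) (formulas-mono (≤⇒≤′ (m≤n⊔m m n)) j)))))))
∈-formulas (¬' a) = let (n , i) = ∈-formulas a in
  suc n , there (there (there (∈-++⁺ʳ (formulas n) (∈-++⁺ˡ (∈-map⁺ ¬'_ i)))))
∈-formulas (◇ a) = let (n , i) = ∈-formulas a in
  suc n , there (there (there (∈-++⁺ʳ (formulas n) (∈-++⁺ʳ (map ¬'_ (formulas n)) (∈-++⁺ˡ (∈-map⁺ ◇_ i))))))

-- Membership is required to be ¬¬-stable, so that classical reasoning about points is available.
record Point : Set₁ where
  infix 4 _∋_
  field
    _∋_    : Fm → Set
    stable : ∀ {a} → ¬ ¬ (_∋_ a) → _∋_ a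
    ∋-thm  : ∀ {a} → wK4⊢ a → _∋_ a
    ∋-mp   : ∀ {a b} → _∋_ (a ⇒ b) → _∋_ a → _∋_ b
    ∋-¬    : ∀ {a} → _∋_ (¬' a) → ¬ (_∋_ a)
    ∌⇒∋¬   : ∀ {a} → ¬ (_∋_ a) → _∋_ (¬' a)

  ∋-⊢ : ∀ {a b} → wK4⊢ (a ⇒ b) → _∋_ a → _∋_ b
  ∋-⊢ d = ∋-mp (∋-thm d)

  ∋-∧⁺ : ∀ {a b} → _∋_ a → _∋_ b → _∋_ (a ∧' b)
  ∋-∧⁺ {a} {b} p q = ∋-mp (∋-⊢ (tautology (x₀ ⊃ x₁ ⊃ (x₀ & x₁)) {refl} (a ∷ b ∷ [])) p) q

  ∋-∧ˡ : ∀ {a b} → _∋_ (a ∧' b) → _∋_ a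
  ∋-∧ˡ {a} {b} = ∋-⊢ (tautology ((x₀ & x₁) ⊃ x₀) {refl} (a ∷ b ∷ []))

  ∋-∧ʳ : ∀ {a b} → _∋_ (a ∧' b) → _∋_ b
  ∋-∧ʳ {a} {b} = ∋-⊢ (tautology ((x₀ & x₁) ⊃ x₁) {refl} (a ∷ b ∷ []))

open Point

lindenbaum : (T : Theory) → Consistent T → Σ Point λ x → ∀ {a} → mem T a → x ∋ a
lindenbaum T con = x , λ m → return (0 , m)
  where
  stage : ℕ → Theory
  stage zero = T
  stage (suc n) = extendAll (stage n) (formulas n)

  stage-consistent : ∀ n → Consistent (stage n)
  stage-consistent zero = con
  stage-consistent (suc n) = extendAll-consistent (stage n) (formulas n) (stage-consistent n)

  stage-mono : ∀ {m n a} → m ≤′ n → mem (stage m) a → mem (stage n) a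
  stage-mono ≤′-refl h = h
  stage-mono (≤′-step {n} p) h = extendAll-⊇ (stage n) (formulas n) (stage-mono p h)

  limit : Fm → Set
  limit a = ∃[ n ] mem (stage n) a

  limit-mp : ∀ {a b} → limit (a ⇒ b) → limit a → limit b
  limit-mp (m , f) (n , h) = m ⊔ n ,
    mpT (stage (m ⊔ n)) (stage-mono (≤⇒≤′ (m≤m⊔n m n)) f) (stage-mono (≤⇒≤′ (m≤n⊔m m n)) h)

  limit-consistent : ¬ limit fls
  limit-consistent (n , h) = stage-consistent n h

  limit-thm : ∀ {a} → wK4⊢ a → limit a
  limit-thm d = 0 , thm T d

  limit-decides : ∀ a → ¬ ¬ (limit a ⊎ limit (¬' a))
  limit-decides a = let (n , i) = ∈-formulas a in
    extendAll-decides (stage n) (formulas n) i >>= λ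
      { (inj₁ h) → return (inj₁ (suc n , h)) ; (inj₂ h) → return (inj₂ (suc n , h)) }

  x : Point
  x = record
    -- `limit` decides each formula only up to double negation; the outer `¬ ¬` makes membership
    -- stable.
    { _∋_ = λ a → ¬ ¬ limit a
    ; stable = λ h k → h λ h' → h' k
    ; ∋-thm = return ∘ limit-thm
    ; ∋-mp = λ f h → f >>= λ f' → h >>= λ h' → return (limit-mp f' h')
    ; ∋-¬ = λ {a} n h → n λ n' → h λ h' → limit-consistent
        (limit-mp (limit-mp (limit-thm (tautology (∼ x₀ ⊃ x₀ ⊃ ff) {refl} (a ∷ []))) n') h')
    ; ∌⇒∋¬ = λ {a} n → limit-decides a >>= λ
        { (inj₁ h) → ⊥-elim (n (return h)) ; (inj₂ h) → return h } }

infix 4 _⟶_ _≈_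

record _⟶_ (x y : Point) : Set where
  constructor edge
  field ◇-∋ : ∀ {a} → y ∋ a → x ∋ ◇ a
open _⟶_

-- Stands in for equality of points. One inclusion suffices, since points are maximal; see `≈-sym`.
record _≈_ (x y : Point) : Set where
  constructor same
  field ∋-cong : ∀ {a} → x ∋ a → y ∋ a
open _≈_

≈-sym : ∀ {x y} → x ≈ y → y ≈ x
≈-sym {x} {y} e = same λ h → stable x λ n → ∋-¬ y (∋-cong e (∌⇒∋¬ x n)) h

⟶-stable : ∀ {x y} → ¬ ¬ (x ⟶ y) → x ⟶ y
⟶-stable {x} nn = edge λ h → stable x λ n → nn λ r → n (◇-∋ r h)

≈-stable : ∀ {x y} → ¬ ¬ (x ≈ y) → x ≈ y
≈-stable {y = y} nn = same λ h → stable y λ n → nn λ r → n (∋-cong r h)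

-- The point `y` extends the set of all `b` with `□ (g ⇒ b)` in `x` for some `g` in `G`. This set is
-- consistent because `x` contains `◇ g`, and the case where `g` is `tru` gives the edge.
successor : (x : Point) (G : Fm → Set) → G tru → (∀ {a b} → G a → G b → G (a ∧' b)) →
  (∀ {a} → G a → x ∋ ◇ a) → Σ Point λ y → x ⟶ y × (∀ {a} → G a → y ∋ a)
successor x G G⊤ G∧ G⇒◇ = y , x⟶y , λ {a} g → T⊆y (a , g , ∋-thm x (nec (⇒-refl a)))
  where
  T : Theory
  T = record
    { mem = λ b → ∃[ g ] (G g × x ∋ □ (g ⇒ b))
    ; thm = λ {b} d → tru , G⊤ , ∋-thm x (nec (⇒-const d))
    ; mpT = λ {b} {c} (g , Gg , h) (g' , Gg' , h') → (g ∧' g') , G∧ Gg Gg' ,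
        ∋-mp x (∋-⊢ x (axK _ _) (∋-⊢ x (□-mono
          (tautology ((x₀ ⊃ x₂ ⊃ x₃) ⊃ (x₁ ⊃ x₂) ⊃ ((x₀ & x₁) ⊃ x₃)) {refl} (g ∷ g' ∷ b ∷ c ∷ []))) h)) h' }

  T-consistent : Consistent T
  T-consistent (g , Gg , h) = ∋-¬ x h
    (∋-⊢ x (◇-mono (tautology (x₀ ⊃ ∼ (x₀ ⊃ ff)) {refl} (g ∷ []))) (G⇒◇ Gg))

  y = proj₁ (lindenbaum T T-consistent)

  T⊆y : ∀ {a} → mem T a → y ∋ a
  T⊆y = proj₂ (lindenbaum T T-consistent)

  x⟶y : x ⟶ y
  x⟶y = edge λ {b} h → stable x λ n → ∋-¬ y (T⊆y (tru , G⊤ ,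
    ∌⇒∋¬ x (n ∘ ∋-⊢ x (◇-mono (tautology (∼ (x₁ ⊃ ∼ x₀) ⊃ x₀) {refl} (b ∷ tru ∷ [])))))) h

◇-witness : ∀ x {a} → x ∋ ◇ a → Σ Point λ y → x ⟶ y × y ∋ a
◇-witness x {a} h =
  let (y , r , s) = successor x (λ b → wK4⊢ (a ⇒ b)) (⇒-const ⊢-tru) ⇒-∧
        (λ d → ∋-⊢ x (◇-mono d) h)
  in y , r , s (⇒-refl a)

-- If some `b` lies in `z` but not in `x`, then for each `a` in `z` the axiom `axW` for `a ∧' b`
-- leaves only `◇ (a ∧' b)` in `x`, which yields the edge. The disjunction is written as an
-- implication to avoid deciding it.
⟶-weakly-transitive : ∀ {x y z} → x ⟶ y → y ⟶ z → ¬ (x ⟶ z) → x ≈ z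
⟶-weakly-transitive {x} {y} {z} r s ¬t = ≈-sym (same λ {b} z∋b → stable x λ x∌b → ¬t (edge λ {a} z∋a →
  ∋-⊢ x (◇-mono (tautology ((x₀ & x₁) ⊃ x₀) {refl} (a ∷ b ∷ [])))
    (∋-mp x (∋-⊢ x (axW (a ∧' b)) (◇-∋ r (◇-∋ s (∋-∧⁺ z z∋a z∋b)))
      |> ∋-⊢ x (tautology (∼ (∼ x₀ & ∼ x₁) ⊃ ∼ x₀ ⊃ x₁) {refl} (a ∧' b ∷ ◇ (a ∧' b) ∷ [])))
      (∌⇒∋¬ x (x∌b ∘ ∋-∧ʳ x {a})))))

-- Formulas in the common variables

module Agreement (φ ψ : Fm) where

  Common : Fm → Set
  Common a = ∀ p → p ∈ sig a → p ∈ sig φ × p ∈ sig ψ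

  common-⊤ : Common tru
  common-⊤ _ ()

  common-∧ : ∀ {a b} → Common a → Common b → Common (a ∧' b)
  common-∧ {a} f g p i = [ f p , g p ]′ (∈-++⁻ (sig a) i)

  infix 4 _~_
  record _~_ (x y : Point) : Set where
    constructor agree
    field ∋-common : ∀ {a} → Common a → x ∋ a → y ∋ a
  open _~_ public

  ~-refl : ∀ {x} → x ~ x
  ~-refl = agree λ _ h → h

  ~-trans : ∀ {x y z} → x ~ y → y ~ z → x ~ z
  ~-trans e f = agree λ c h → ∋-common f c (∋-common e c h)

  ~-sym : ∀ {x y} → x ~ y → y ~ x
  ~-sym {x} {y} e = agree λ {a} c h → stable x λ n → ∋-¬ y (∋-common e {¬' a} c (∌⇒∋¬ x n)) h

  -- `successor` is applied to the common formulas of `x'`: their diamonds lie in `x`, hence in `y`.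
  ~-bisimulation : ∀ {x y x'} → x ~ y → x ⟶ x' → Σ Point λ y' → y ⟶ y' × x' ~ y'
  ~-bisimulation {x} {y} {x'} e r =
    let (y' , r' , s) = successor y (λ a → Common a × x' ∋ a)
          (common-⊤ , ∋-thm x' ⊢-tru)
          (λ {a} {b} (c , h) (c' , h') → common-∧ {a} {b} c c' , ∋-∧⁺ x' h h')
          (λ {a} (c , h) → ∋-common e {◇ a} c (◇-∋ r h))
    in y' , r' , agree λ c h → s (c , h)

  -- `y` extends `¬' ψ` and all common consequences of `φ`; an inconsistency would turn one of these
  -- into an interpolant. `x` extends `φ` and all common formulas of `y`; an inconsistency would
  -- make the negation of one of them a common consequence of `φ`, hence a member of `y`.
  agreeing-points : ¬ HasInterpolant φ ψ →
    Σ Point λ x → Σ Point λ y → x ∋ φ × y ∋ ¬' ψ × x ~ y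
  agreeing-points ¬ι = x , y , T'⊆x (tru , common-⊤ , ∋-thm y ⊢-tru ,
      tautology ((x₀ & x₁) ⊃ x₀) {refl} (φ ∷ tru ∷ [])) ,
    T⊆y (tru , common-⊤ , ⇒-const ⊢-tru ,
      tautology (x₁ ⊃ x₀ ⊃ x₀) {refl} (¬' ψ ∷ tru ∷ [])) ,
    ~-sym (agree λ {a} c h → T'⊆x (a , c , h , tautology ((x₀ & x₁) ⊃ x₁) {refl} (φ ∷ a ∷ [])))
    where
    T : Theory
    T = record
      { mem = λ b → ∃[ χ ] (Common χ × wK4⊢ (φ ⇒ χ) × wK4⊢ (χ ⇒ ¬' ψ ⇒ b))
      ; thm = λ {b} d → tru , common-⊤ ,
          ⇒-const ⊢-tru ,
          ⇒-const (⇒-const d)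
      ; mpT = λ {b} {b'} (χ , c , φ⇒χ , f) (χ' , c' , φ⇒χ' , h) →
          (χ ∧' χ') , common-∧ {χ} {χ'} c c' ,
          ⇒-∧ φ⇒χ φ⇒χ' ,
          mp (mp (tautology ((x₀ ⊃ x₂ ⊃ x₃ ⊃ x₄) ⊃ (x₁ ⊃ x₂ ⊃ x₃) ⊃ ((x₀ & x₁) ⊃ x₂ ⊃ x₄)) {refl}
            (χ ∷ χ' ∷ ¬' ψ ∷ b ∷ b' ∷ [])) f) h }

    T-consistent : Consistent T
    T-consistent (χ , c , φ⇒χ , h) = ¬ι (χ , (λ {p} → c p) , φ⇒χ ,
      mp (tautology ((x₀ ⊃ ∼ x₁ ⊃ ff) ⊃ x₀ ⊃ x₁) {refl} (χ ∷ ψ ∷ [])) h)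

    y = proj₁ (lindenbaum T T-consistent)

    T⊆y : ∀ {a} → mem T a → y ∋ a
    T⊆y = proj₂ (lindenbaum T T-consistent)

    T' : Theory
    T' = record
      { mem = λ b → ∃[ χ ] (Common χ × y ∋ χ × wK4⊢ (φ ∧' χ ⇒ b))
      ; thm = λ {b} d → tru , common-⊤ , ∋-thm y ⊢-tru ,
          ⇒-const d
      ; mpT = λ {b} {b'} (χ , c , y∋χ , f) (χ' , c' , y∋χ' , h) →
          (χ ∧' χ') , common-∧ {χ} {χ'} c c' , ∋-∧⁺ y y∋χ y∋χ' ,
          mp (mp (tautology (((x₂ & x₀) ⊃ x₃ ⊃ x₄) ⊃ ((x₂ & x₁) ⊃ x₃) ⊃ ((x₂ & x₀ & x₁) ⊃ x₄)) {refl}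
            (χ ∷ χ' ∷ φ ∷ b ∷ b' ∷ [])) f) h }

    T'-consistent : Consistent T'
    T'-consistent (χ , c , y∋χ , h) = ∋-¬ y (T⊆y (¬' χ , c ,
      mp (tautology (((x₀ & x₁) ⊃ ff) ⊃ x₀ ⊃ ∼ x₁) {refl} (φ ∷ χ ∷ [])) h ,
      tautology (x₀ ⊃ x₁ ⊃ x₀) {refl} (¬' χ ∷ ¬' ψ ∷ []))) y∋χ

    x = proj₁ (lindenbaum T' T'-consistent)

    T'⊆x : ∀ {a} → mem T' a → x ∋ a
    T'⊆x = proj₂ (lindenbaum T' T'-consistent)

-- Finite choice under double negation

¬¬-Π : ∀ {n} {P : Fin n → Set ℓ} → (∀ i → ¬ ¬ P i) → ¬ ¬ (∀ i → P i)
¬¬-Π {n = zero} h = return λ ()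
¬¬-Π {n = suc n} h = h zero >>= λ p → ¬¬-Π (h ∘ suc) >>= λ f →
  return λ { zero → p ; (suc i) → f i }

¬¬-Π-↔ : ∀ {n} {A : Set} {P : A → Set ℓ} → Fin n ↔ A → (∀ a → ¬ ¬ P a) → ¬ ¬ (∀ a → P a)
¬¬-Π-↔ {P = P} e h = ¬¬-Π {P = P ∘ Inverse.to e} (h ∘ Inverse.to e) >>= λ f →
  return (λ a → subst P (Inverse.strictlyInverseˡ e a) (f (Inverse.from e a)))

-- Hilbert's ε-operator on a finite index set; the value is the default `d` where nothing satisfies
-- `P a`.
ε-choice : ∀ {n} {A : Set} {P : A → Point → Set ℓ} → Fin n ↔ A → Point →
  ¬ ¬ Σ (A → Point) λ f → ∀ a x → P a x → P a (f a)
ε-choice {P = P} e d = ¬¬-Π-↔ {P = λ a → Σ Point λ y → ∀ x → P a x → P a y} e choose >>= λ f →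
  return ((λ a → proj₁ (f a)) , λ a → proj₂ (f a))
  where
  choose : ∀ a → ¬ ¬ Σ Point λ y → ∀ x → P a x → P a y
  choose a = ¬¬-excluded-middle {A = Σ Point (P a)} >>= λ
    { (yes (y , p)) → return (y , λ _ _ → p)
    ; (no n) → return (d , λ x p → ⊥-elim (n (x , p))) }

-- Subsets of Fin n coded by elements of Fin (2 ^ n)

Bit : ∀ {n} → Fin (2 ^ n) → Fin n → Set
Bit {n} c q = finToFun {2} {n} c q ≡ suc zero

bit? : ∀ {n} (c : Fin (2 ^ n)) q → Dec (Bit c q)
bit? {n} c q = finToFun {2} {n} c q Fin.≟ suc zero

-- Ties a possibly undecidable predicate, of any universe level, to decidable bits.
record Codes {n} (c : Fin (2 ^ n)) (P : Fin n → Set ℓ) : Set ℓ where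
  constructor codes
  field
    bit⇒ : ∀ {q} → Bit c q → P q
    ⇒bit : ∀ {q} → P q → Bit c q
open Codes

finToFun-injective : ∀ {m} n {c d : Fin (m ^ n)} →
  (∀ q → finToFun {m} {n} c q ≡ finToFun d q) → c ≡ d
finToFun-injective zero {zero} {zero} h = refl
finToFun-injective {m} (suc n) {c} {d} h =
  trans (sym (Finₚ.combine-remQuot {m} (m ^ n) c))
    (trans (cong₂ Fin.combine (h zero) (finToFun-injective n (h ∘ suc)))
      (Finₚ.combine-remQuot {m} (m ^ n) d))

code-of : ∀ {n} {P : Fin n → Set ℓ} → (∀ q → Dec (P q)) → Σ (Fin (2 ^ n)) λ c → Codes c P
code-of {n = n} {P} P? = funToFin f , codes
  (λ {q} e → to q (trans (sym (Finₚ.finToFun-funToFin f q)) e))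
  (λ {q} p → trans (Finₚ.finToFun-funToFin f q) (from q p))
  where
  f : Fin n → Fin 2
  f q = if does (P? q) then suc zero else zero
  to : ∀ q → f q ≡ suc zero → P q
  to q e with P? q
  to q _ | yes p = p
  from : ∀ q → P q → f q ≡ suc zero
  from q p with P? q
  ... | yes _ = refl
  ... | no n = ⊥-elim (n p)

codes-exist : ∀ {n} (P : Fin n → Set ℓ) → ¬ ¬ Σ (Fin (2 ^ n)) λ c → Codes c P
codes-exist P = ¬¬-Π (λ q → ¬¬-excluded-middle {A = P q}) >>= λ P? → return (code-of P?)

codes-unique : ∀ {n} {P : Fin n → Set ℓ} {c d} → Codes c P → Codes d P → c ≡ d
codes-unique {n = n} {c = c} {d} f g = finToFun-injective n λ q →
  agreeing-bits (finToFun {2} {n} c q) (finToFun {2} {n} d q) (⇒bit g ∘ bit⇒ f) (⇒bit f ∘ bit⇒ g)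
  where
  agreeing-bits : (i j : Fin 2) → (i ≡ suc zero → j ≡ suc zero) → (j ≡ suc zero → i ≡ suc zero) → i ≡ j
  agreeing-bits zero zero _ _ = refl
  agreeing-bits zero (suc zero) _ g = g refl
  agreeing-bits (suc zero) j f _ = sym (f refl)

-- Clusters of the canonical model

private variable
  x y z : Point

∋-∨ : ∀ x {a b} → x ∋ (a ∨' b) → ¬ ¬ (x ∋ a ⊎ x ∋ b)
∋-∨ x h k = ∋-¬ x h (∋-∧⁺ x (∌⇒∋¬ x (k ∘ inj₁)) (∌⇒∋¬ x (k ∘ inj₂)))

≈-refl : x ≈ x
≈-refl = same id

≈-trans : x ≈ y → y ≈ z → x ≈ z
≈-trans e f = same λ h → ∋-cong f (∋-cong e h)

⟶-≈ˡ : x ≈ y → x ⟶ z → y ⟶ z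
⟶-≈ˡ e r = edge λ h → ∋-cong e (◇-∋ r h)

⟶-≈ʳ : x ⟶ y → y ≈ z → x ⟶ z
⟶-≈ʳ r e = edge λ h → ◇-∋ r (∋-cong (≈-sym e) h)

-- The reflexive closure of ⟶, phrased so that it is ¬¬-stable.
infix 4 _⊴_
record _⊴_ (x y : Point) : Set where
  constructor below
  field unless-edge : ¬ (x ⟶ y) → x ≈ y
open _⊴_

⊴-stable : ¬ ¬ (x ⊴ y) → x ⊴ y
⊴-stable nn = below λ n → ≈-stable λ k → nn λ h → k (unless-edge h n)

⟶⇒⊴ : x ⟶ y → x ⊴ y
⟶⇒⊴ r = below λ n → ⊥-elim (n r)

≈⇒⊴ : x ≈ y → x ⊴ y
≈⇒⊴ e = below λ _ → e

⊴-refl : x ⊴ x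
⊴-refl = ≈⇒⊴ ≈-refl

⊴-cases : x ⊴ y → ¬ ¬ (x ⟶ y ⊎ x ≈ y)
⊴-cases h = ¬¬-excluded-middle >>= λ
  { (yes r) → return (inj₁ r) ; (no n) → return (inj₂ (unless-edge h n)) }

⊴-trans : x ⊴ y → y ⊴ z → x ⊴ z
⊴-trans h k = ⊴-stable (⊴-cases h >>= λ
  { (inj₂ e) → ⊴-cases k >>= λ
      { (inj₂ f) → return (≈⇒⊴ (≈-trans e f))
      ; (inj₁ s) → return (⟶⇒⊴ (⟶-≈ˡ (≈-sym e) s)) }
  ; (inj₁ r) → ⊴-cases k >>= λ
      { (inj₂ f) → return (⟶⇒⊴ (⟶-≈ʳ r f))
      ; (inj₁ s) → return (below (⟶-weakly-transitive r s)) } })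

Cl : Point → Point → Set
Cl c y = c ⊴ y × y ⊴ c

Near : Point → Fm → Set
Near y a = ¬ ¬ (y ∋ a ⊎ y ∋ ◇ a)

-- An edge turns `a` into `◇ a`, and `◇ a` into `◇ ◇ a`, which `axW` reduces to `a` or `◇ a`.
near-⊴ : ∀ {a} → x ⊴ y → Near y a → Near x a
near-⊴ {x} {a = a} h n = ⊴-cases h >>= λ
  { (inj₂ e) → n >>= λ
      { (inj₁ p) → return (inj₁ (∋-cong (≈-sym e) p))
      ; (inj₂ p) → return (inj₂ (∋-cong (≈-sym e) p)) }
  ; (inj₁ r) → n >>= λ
      { (inj₁ p) → return (inj₂ (◇-∋ r p))
      ; (inj₂ p) → ∋-∨ x (∋-⊢ x (axW a) (◇-∋ r p)) } }

-- Types, labels and kernels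

module Filtration (φ ψ : Fm) (L : List Fm) (L-closed : ∀ {a} → ◇ a ∈ L → a ∈ L) where

  open Agreement φ ψ

  ≈⇒~ : x ≈ y → x ~ y
  ≈⇒~ e = agree λ _ → ∋-cong e

  ~-⊴ : ∀ {x x' y} → x ~ x' → x ⊴ y → ¬ ¬ Σ Point λ y' → y ~ y' × x' ⊴ y'
  ~-⊴ {x} {x'} {y} s h = ⊴-cases h >>= λ
    { (inj₂ e) → return (x' , ~-trans (≈⇒~ (≈-sym e)) s , ⊴-refl)
    ; (inj₁ r) → let (y' , r' , s') = ~-bisimulation s r in return (y' , s' , ⟶⇒⊴ r') }

  infix 4 _⊑_ _⋈_
  -- Reachability modulo `~`. It is transitive because `~` is a bisimulation, and the kernels are
  -- classes of its symmetric part `_⋈_`.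
  record _⊑_ (x y : Point) : Set₁ where
    constructor reach
    field reached : ¬ ¬ Σ Point λ y' → y ~ y' × x ⊴ y'
  open _⊑_

  _⋈_ : Point → Point → Set₁
  x ⋈ y = x ⊑ y × y ⊑ x

  ⊑-trans : x ⊑ y → y ⊑ z → x ⊑ z
  ⊑-trans h k = reach (reached h >>= λ (y' , s , l) → reached k >>= λ (z' , t , m) →
    ~-⊴ s m >>= λ (z'' , u , n) → return (z'' , ~-trans t u , ⊴-trans l n))

  ⊴⇒⊑ : x ⊴ y → x ⊑ y
  ⊴⇒⊑ h = reach (return (_ , ~-refl , h))

  ~⇒⊑ : x ~ y → x ⊑ y
  ~⇒⊑ s = reach (return (_ , ~-sym s , ⊴-refl))

  ~⇒⋈ : x ~ y → x ⋈ y
  ~⇒⋈ s = ~⇒⊑ s , ~⇒⊑ (~-sym s)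

  ⋈-refl : x ⋈ x
  ⋈-refl = ~⇒⋈ ~-refl

  ⋈-trans : x ⋈ y → y ⋈ z → x ⋈ z
  ⋈-trans (h , k) (h' , k') = ⊑-trans h h' , ⊑-trans k' k

  Cl⇒⋈ : Cl x y → x ⋈ y
  Cl⇒⋈ (h , k) = ⊴⇒⊑ h , ⊴⇒⊑ k

  Typ Lab : Set
  Typ = Fin (2 ^ length L)
  Lab = Fin (2 ^ (2 ^ length L))

  record HasTyp (y : Point) (s : Typ) : Set where
    constructor typed
    field typ-codes : Codes s λ q → y ∋ List.lookup L q
  open HasTyp

  record HasLab (y : Point) (Z : Lab) : Set₁ where
    constructor labelled
    field lab-codes : Codes Z λ t → ¬ ¬ Σ Point λ y' → y ~ y' × HasTyp y' t
  open HasLab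

  typ-exists : ∀ y → ¬ ¬ Σ Typ (HasTyp y)
  typ-exists y = codes-exist _ >>= λ (s , c) → return (s , typed c)

  lab-exists : ∀ y → ¬ ¬ Σ Lab (HasLab y)
  lab-exists y = codes-exist _ >>= λ (Z , c) → return (Z , labelled c)

  lab-unique : ∀ {Z Z'} → HasLab x Z → HasLab x Z' → Z ≡ Z'
  lab-unique l l' = codes-unique (lab-codes l) (lab-codes l')

  typ-∋ : ∀ {s a} → a ∈ L → HasTyp x s → HasTyp y s → x ∋ a → y ∋ a
  typ-∋ {x} {y} a∈ t u h = subst (y ∋_) (sym (lookup-index a∈))
    (bit⇒ (typ-codes u) (⇒bit (typ-codes t) (subst (x ∋_) (lookup-index a∈) h)))

  typ-≈ : ∀ {s} → x ≈ y → HasTyp x s → HasTyp y s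
  typ-≈ e t = typed (codes (∋-cong e ∘ bit⇒ (typ-codes t)) (⇒bit (typ-codes t) ∘ ∋-cong (≈-sym e)))

  lab-~ : ∀ {Z} → x ~ y → HasLab x Z → HasLab y Z
  lab-~ s l = labelled (codes
    (λ b → bit⇒ (lab-codes l) b >>= λ (u , s' , t) → return (u , ~-trans (~-sym s) s' , t))
    (λ h → ⇒bit (lab-codes l) (h >>= λ (u , s' , t) → return (u , ~-trans s s' , t))))

  -- Serves to exchange a point for one of the same type in the `~`-class of a chosen
  -- representative.
  lab-transfer : ∀ {Z s} → HasLab x Z → HasLab y Z → HasTyp x s → ¬ ¬ Σ Point λ u → y ~ u × HasTyp u s
  lab-transfer l m t = bit⇒ (lab-codes m) (⇒bit (lab-codes l) (return (_ , ~-refl , t)))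

  CTyp : Set
  CTyp = Lab × Typ

  HasCTyp : Point → CTyp → Set₁
  HasCTyp y (Z , s) = HasLab y Z × HasTyp y s

  ctyp-unique : ∀ {b b'} → HasCTyp x b → HasCTyp x b' → b ≡ b'
  ctyp-unique (l , t) (l' , t') = cong₂ _,_ (lab-unique l l') (codes-unique (typ-codes t) (typ-codes t'))

  ctyp-≈ : ∀ {b} → x ≈ y → HasCTyp x b → HasCTyp y b
  ctyp-≈ e (l , t) = lab-~ (≈⇒~ e) l , typ-≈ e t

  -- Stated for a single `y`; `dominates-⊴` extends it to everything that `y` reaches, in particular
  -- to its cluster. Covering `◇ a` at `y`, and not only `a`, makes the relation transitive.
  record Dominates (c y : Point) : Set₁ where
    constructor dominating
    field dominate : ∀ z → Cl c z → ∀ {a} → ◇ a ∈ L → Near y a → z ∋ ◇ a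
  open Dominates

  -- Both `a` and `◇ a` belong to `L` and can be read off the type of the dominated point.
  dominates-typ : ∀ {c s} → HasTyp x s → HasTyp y s → Dominates c x → Dominates c y
  dominates-typ t u d = dominating λ z cl ◇a∈ n → dominate d z cl ◇a∈ (n >>= λ
    { (inj₁ p) → return (inj₁ (typ-∋ (L-closed ◇a∈) u t p))
    ; (inj₂ p) → return (inj₂ (typ-∋ ◇a∈ u t p)) })

  dominates-⊴ : ∀ {c} → x ⊴ y → Dominates c x → Dominates c y
  dominates-⊴ h d = dominating λ z cl ◇a∈ n → dominate d z cl ◇a∈ (near-⊴ h n)

  dominates-trans : Dominates x y → Dominates y z → Dominates x z
  dominates-trans {y = y} d e = dominating λ w cl ◇a∈ n →
    dominate d w cl ◇a∈ (return (inj₂ (dominate e y (⊴-refl , ⊴-refl) ◇a∈ n)))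

  -- Every `z` in the cluster of `x` sees `y`. If `y` sees `w` with `a`, then `z` sees `w` or
  -- `z ≈ w`; in the latter case `y` would lead back into the cluster of `x`.
  strictly-above⇒dominates : x ⊴ y → ¬ (y ⊴ x) → Dominates x y
  strictly-above⇒dominates {x} {y} h ¬k = dominating λ z (x⊴z , z⊴x) ◇a∈ n → stable z (n >>= λ
    { (inj₁ p) → return (◇-∋ (z⟶y z⊴x) p)
    ; (inj₂ p) → let (w , y⟶w , w∋a) = ◇-witness y p in ¬¬-excluded-middle >>= λ
      { (yes z⟶w) → return (◇-∋ z⟶w w∋a)
      ; (no ¬z⟶w) → ⊥-elim (¬y⊴ z⊴x (⟶⇒⊴ (⟶-≈ʳ y⟶w
          (≈-sym (⟶-weakly-transitive (z⟶y z⊴x) y⟶w ¬z⟶w))))) } })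
    where
    ¬y⊴ : ∀ {z} → z ⊴ x → ¬ (y ⊴ z)
    ¬y⊴ z⊴x k = ¬k (⊴-trans k z⊴x)
    z⟶y : ∀ {z} → z ⊴ x → z ⟶ y
    z⟶y z⊴x = ⟶-stable λ n → ¬y⊴ z⊴x (≈⇒⊴ (≈-sym (unless-edge (⊴-trans z⊴x h) n)))

  Irreflexive : Point → Lab → Set₁
  Irreflexive y Z = ∀ y₁ y₂ → y ⋈ y₁ → y ⋈ y₂ → HasLab y₁ Z → HasLab y₂ Z → ¬ (y₁ ⟶ y₂)

  Rigid : Point → Set₁
  Rigid c = ¬ ¬ Σ Lab λ Z → Σ Point λ y → Cl c y × HasLab y Z × Irreflexive y Z

  -- A point with an irreflexive label sees no point ~ itself, so a path from it through y that comes
  -- back to its ~-class ends in the point itself.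
  rigid-maximal : Rigid x → x ⊴ y → y ⊑ x → y ⊴ x
  rigid-maximal {x} {y} rig h k = ⊴-stable (rig >>= λ (Z , z , (x⊴z , z⊴x) , l , irr) →
    reached (⊑-trans k (⊴⇒⊑ x⊴z)) >>= λ (w , z~w , y⊴w) →
    ⊴-cases (⊴-trans z⊴x (⊴-trans h y⊴w)) >>= λ
      { (inj₁ z⟶w) → ⊥-elim (irr z w ⋈-refl (~⇒⋈ z~w) l (lab-~ z~w l) z⟶w)
      ; (inj₂ z≈w) → return (⊴-trans y⊴w (⊴-trans (≈⇒⊴ (≈-sym z≈w)) z⊴x)) })

  Ix : Set
  Ix = (Lab × CTyp) × CTyp

  lab : Ix → Lab
  lab ((X , _) , (Z , _)) = Z

  typ : Ix → Typ
  typ (_ , (_ , s)) = s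

  kernel : Ix → Lab
  kernel ((X , _) , _) = X

  Has : Typ → Fm → Set
  Has s a = ∃[ q ] (List.lookup L q ≡ a × Bit s q)

  -- Types are finite codes, so this is decidable although membership in points is not; double
  -- negations are discharged through it.
  has? : ∀ s a → Dec (Has s a)
  has? s a = Finₚ.any? λ q → (List.lookup L q ≟Fm a) ×-dec bit? s q

  has⇒∋ : ∀ {y s a} → HasTyp y s → Has s a → y ∋ a
  has⇒∋ t (q , refl , b) = bit⇒ (typ-codes t) b

  ∋⇒has : ∀ {y s a} → a ∈ L → HasTyp y s → y ∋ a → Has s a
  ∋⇒has {y} a∈ t h = Any.index a∈ , sym (lookup-index a∈) ,
    ⇒bit (typ-codes t) (subst (y ∋_) (lookup-index a∈) h)

  -- The finite model over chosen representatives

  module Quotient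
    (ρ : Lab → Point)
    (ρ-lab : ∀ X x → HasLab x X → HasLab (ρ X) X)
    (κ : Lab × CTyp → Point)
    (κ-spec : ∀ i y → ρ (proj₁ i) ⋈ y × HasCTyp y (proj₂ i) →
              ρ (proj₁ i) ⋈ κ i × HasCTyp (κ i) (proj₂ i))
    where

    -- ρ and κ take arbitrary values at labels and types that are not realised.
    record Valid (i : Ix) : Set₁ where
      constructor valid
      field
        kernel-lab : HasLab (ρ (kernel i)) (kernel i)
        over       : ρ (kernel i) ⋈ κ (proj₁ i)
        inhabited  : ¬ ¬ Σ Point λ y → Cl (κ (proj₁ i)) y × HasCTyp y (proj₂ i)
    open Valid

    -- All `d` of the kernel are covered so that an `above` step can be repeated from every twin of
    -- its source.
    _≺_ : Lab → Lab → Set₁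
    X ≺ Y = ∀ d → ρ X ⋈ d → ¬ ¬ Σ Point λ u → ρ Y ~ u × Dominates d u

    -- Decides when a `within` step may be a loop. The two points may be one reflexive point.
    Doubled : Point → CTyp → Set₁
    Doubled c b = ¬ ¬ Σ Point λ y → Σ Point λ y' →
      Cl c y × Cl c y' × HasCTyp y b × HasCTyp y' b × y ⟶ y'

    -- No across step leaves a rigid cluster: it would have to be matched at all points with an
    -- irreflexive label, which see no point of that label.
    data Step : Ix → Ix → Set₁ where
      within : ∀ {C b b'} → b ≢ b' ⊎ Doubled (κ C) b → Step (C , b) (C , b')
      across : ∀ {X b₀ b₀' b b'} → ¬ Rigid (κ (X , b₀)) → Dominates (κ (X , b₀)) (κ (X , b₀')) →
               Step ((X , b₀) , b) ((X , b₀') , b')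
      above  : ∀ {C C' b b'} → proj₁ C ≺ proj₁ C' → Dominates (κ C) (κ C') → Step (C , b) (C' , b')

    -- Indices that are not Valid are isolated and disappear in generated submodels.
    Rel : Ix → Ix → Set₁
    Rel i j = Valid i × Valid j × Step i j

    ≺-trans : ∀ {X Y Z} → X ≺ Y → Y ≺ Z → X ≺ Z
    ≺-trans h k d o = h d o >>= λ (u , s , D) → k u (~⇒⋈ s) >>= λ (w , s' , D') →
      return (w , s' , dominates-trans D D')

    -- The conditions on `across` and `above` concern only the clusters, so a neighbouring `within`
    -- step is absorbed. Two `within` steps compose unless they return to their start, whence
    -- `i ≢ k`.
    step-trans : ∀ {i j k} → Valid j → Step i j → Step j k → i ≢ k → Step i k
    step-trans _ (within _) (within _) ≢ = within (inj₁ λ { refl → ≢ refl })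
    step-trans _ (within _) (across r d) _ = across r d
    step-trans _ (within _) (above p d) _ = above p d
    step-trans _ (across r d) (within _) _ = across r d
    step-trans _ (across r d) (across _ d') _ = across r (dominates-trans d d')
    step-trans vj (across r d) (above p d') _ = above p (dominates-trans d d')
    step-trans _ (above p d) (within _) _ = above p d
    step-trans _ (above p d) (across _ d') _ = above p (dominates-trans d d')
    step-trans _ (above p d) (above p' d') _ = above (≺-trans p p') (dominates-trans d d')

    rel-weakly-transitive : ∀ {i j k} → Rel i j → Rel j k → i ≢ k → Rel i k
    rel-weakly-transitive (vi , vj , r) (_ , vk , s) ≢ = vi , vk , step-trans vj r s ≢

    valid-κ : ∀ {X b y} → HasLab (ρ X) X → ρ X ⋈ y → HasCTyp y b → Valid ((X , b) , b)
    valid-κ {X} {b} {y} l o t = let (o' , t') = κ-spec (X , b) y (o , t) in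
      valid l o' (return (κ (X , b) , (⊴-refl , ⊴-refl) , t'))

    dominates-κ : ∀ {X b c y} → ρ X ⋈ y → HasCTyp y b → Dominates c y → Dominates c (κ (X , b))
    dominates-κ {X} {b} {c} {y} o t = dominates-typ (proj₂ t) (proj₂ (proj₂ (κ-spec (X , b) y (o , t))))

    -- If `w` stays in the cluster, the step is `within`. Otherwise the cluster is not rigid by
    -- `rigid-maximal`, and it dominates `w` because `w` does not lead back to it.
    rel-inside : ∀ {C b y w b'} → Valid (C , b) → Cl (κ C) y → HasCTyp y b → y ⟶ w →
      ρ (proj₁ C) ⋈ w → HasCTyp w b' → ¬ ¬ Σ CTyp λ b₀' → Rel (C , b) ((proj₁ C , b₀') , b')
    rel-inside {C} {b} {y} {w} {b'} v (c⊴y , y⊴c) t y⟶w o t' = ¬¬-excluded-middle {A = w ⊴ κ C} >>= λ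
      { (yes w⊴c) → return (proj₂ C , v ,
          valid (kernel-lab v) (over v) (return (w , (c⊴w , w⊴c) , t')) ,
          within (doubled w⊴c))
      ; (no ¬w⊴c) → return (b' , v , valid-κ (kernel-lab v) o t' , across
          (λ rig → ¬w⊴c (rigid-maximal rig c⊴w (⊑-trans (proj₂ o) (proj₁ (over v)))))
          (dominates-κ o t' (strictly-above⇒dominates c⊴w ¬w⊴c))) }
      where
      c⊴w : κ C ⊴ w
      c⊴w = ⊴-trans c⊴y (⟶⇒⊴ y⟶w)
      doubled : w ⊴ κ C → b ≢ b' ⊎ Doubled (κ C) b
      doubled w⊴c with ≡-dec Fin._≟_ Fin._≟_ b b'
      ... | no ≢ = inj₁ ≢
      ... | yes refl = inj₂ (return (y , w , (c⊴y , y⊴c) , (c⊴w , w⊴c) , t , t' , y⟶w))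

    -- The target lies over the label `Y` of `w` and is given by a point of the type of `w` in the
    -- `~`-class of `ρ Y`.
    rel-outside : ∀ {C b y w s} → Valid (C , b) → Cl (κ C) y → y ⟶ w →
      ¬ (ρ (proj₁ C) ⋈ w) → HasTyp w s → ¬ ¬ Σ Ix λ j → Rel (C , b) j × typ j ≡ s
    rel-outside {C@(X , _)} {b} {y} {w} {s} v (c⊴y , y⊴c) y⟶w ¬o t =
      lab-exists w >>= λ (Y , wY) →
      lab-transfer wY (ρ-lab Y w wY) t >>= λ (u , ρY~u , ut) →
      let uY = lab-~ ρY~u (ρ-lab Y w wY)
          o = ~⇒⋈ ρY~u
      in return (((Y , (Y , s)) , (Y , s)) ,
        (v , valid-κ (ρ-lab Y w wY) o (uY , ut) ,
          above (kernel-step wY)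
            (dominates-κ o (uY , ut)
              (dominates-typ t ut (strictly-above⇒dominates c⊴w
                λ w⊴c → ¬o (⊑-trans (proj₁ (over v)) (⊴⇒⊑ c⊴w) , ⊑-trans (⊴⇒⊑ w⊴c) (proj₂ (over v))))))) ,
        refl)
      where
      c⊴w : κ C ⊴ w
      c⊴w = ⊴-trans c⊴y (⟶⇒⊴ y⟶w)
      kernel-step : ∀ {Y} → HasLab w Y → X ≺ Y
      -- Every `d` of the kernel reaches some `w'` with `w ~ w'`, and `w'` does not lead back to
      -- `d`, as otherwise `w` would belong to the kernel.
      kernel-step {Y} wY d o =
        reached (⊑-trans (proj₂ o) (⊑-trans (proj₁ (over v)) (⊴⇒⊑ c⊴w))) >>= λ (w' , w~w' , d⊴w') →
        typ-exists w' >>= λ (s' , t') →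
        lab-transfer (lab-~ w~w' wY) (ρ-lab Y w wY) t' >>= λ (u , ρY~u , ut) →
        return (u , ρY~u , dominates-typ t' ut (strictly-above⇒dominates d⊴w'
          λ w'⊴d → ¬o (⊑-trans (proj₁ (over v)) (⊴⇒⊑ c⊴w) ,
                       ⊑-trans (~⇒⊑ w~w') (⊑-trans (⊴⇒⊑ w'⊴d) (proj₂ o)))))

    has-¬¬ : ∀ {i a} → Valid i → a ∈ L → (∀ {y} → HasTyp y (typ i) → ¬ ¬ (y ∋ a)) → Has (typ i) a
    has-¬¬ {i} {a} v a∈ f = decidable-stable (has? (typ i) a)
      (inhabited v >>= λ (y , _ , _ , t) → f t >>= λ p → return (∋⇒has a∈ t p))

    has-consistent : ∀ {i a} → Valid i → Has (typ i) a → Has (typ i) (¬' a) → ⊥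
    has-consistent v h n = inhabited v λ (y , _ , _ , t) → ∋-¬ y (has⇒∋ t n) (has⇒∋ t h)

    ¬has-fls : ∀ {i} → Valid i → ¬ Has (typ i) fls
    ¬has-fls v h = inhabited v λ (y , _ , _ , t) → ∋-¬ y (∋-thm y (taut λ _ → refl)) (has⇒∋ t h)

    has-¬ : ∀ {i a} → Valid i → a ∈ L → ¬' a ∈ L → ¬ Has (typ i) a → Has (typ i) (¬' a)
    has-¬ v a∈ ¬a∈ n = has-¬¬ v ¬a∈ λ {y} t → return (∌⇒∋¬ y λ p → n (∋⇒has a∈ t p))

    -- Two points of one cluster are joined by an edge unless they coincide; in that case label and
    -- type agree and `Doubled` provides the edge. The other steps carry domination.
    rel-◇⁺ : ∀ {i j a} → Rel i j → ◇ a ∈ L → Has (typ j) a → Has (typ i) (◇ a)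
    rel-◇⁺ {i} {j} {a} (vi , vj , st) ◇a∈ h = decidable-stable (has? (typ i) (◇ a))
      (inhabited vi >>= λ (y , cl , t) → inhabited vj >>= λ (y' , cl' , t') →
       go st cl t cl' t' >>= λ p → return (∋⇒has ◇a∈ (proj₂ t) p))
      where
      dominated : ∀ {y y' C C' Z} → Dominates (κ C) (κ C') → Cl (κ C) y → Cl (κ C') y' →
        HasCTyp y' (Z , typ j) → y ∋ ◇ a
      dominated {y} d cl (c⊴ , _) t' =
        dominate d y cl ◇a∈ (near-⊴ c⊴ (return (inj₁ (has⇒∋ (proj₂ t') h))))
      go : ∀ {y y'} → Step i j → Cl (κ (proj₁ i)) y → HasCTyp y (proj₂ i) →
        Cl (κ (proj₁ j)) y' → HasCTyp y' (proj₂ j) → ¬ ¬ (y ∋ ◇ a)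
      go {y} {y'} (within m) cl t cl' t' = ⊴-cases (⊴-trans (proj₂ cl) (proj₁ cl')) >>= λ
        { (inj₁ r) → return (◇-∋ r (has⇒∋ (proj₂ t') h))
        ; (inj₂ e) → [ (λ ≢ → ⊥-elim (≢ (ctyp-unique (ctyp-≈ e t) t')))
                     , (λ dbl → dbl >>= λ (y₁ , y₂ , _ , _ , t₁ , t₂ , r) →
                         return (typ-∋ ◇a∈ (proj₂ t₁) (proj₂ t) (◇-∋ r (has⇒∋
                           (subst (HasTyp y₂) (cong proj₂ (ctyp-unique (ctyp-≈ e t) t')) (proj₂ t₂)) h)))) ]′ m }
      go (across _ d) cl t cl' t' = return (dominated d cl cl' t')
      go (above _ d) cl t cl' t' = return (dominated d cl cl' t')

    rel-◇⁻ : ∀ {i a} → Valid i → ◇ a ∈ L → Has (typ i) (◇ a) → ¬ ¬ Σ Ix λ j → Rel i j × Has (typ j) a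
    rel-◇⁻ {i} {a} v ◇a∈ h = inhabited v >>= λ (y , cl , t) →
      let (w , r , w∋a) = ◇-witness y (has⇒∋ (proj₂ t) h) in
      typ-exists w >>= λ (s , ws) →
      lab-exists w >>= λ (Z , wZ) →
      ¬¬-excluded-middle {A = ρ (kernel i) ⋈ w} >>= λ
        { (yes o) → rel-inside v cl t r o (wZ , ws) >>= λ (b₀ , rel) →
            return (_ , rel , ∋⇒has (L-closed ◇a∈) ws w∋a)
        ; (no ¬o) → rel-outside v cl r ¬o ws >>= λ { (j , rel , refl) →
            return (j , rel , ∋⇒has (L-closed ◇a∈) ws w∋a) } }

    Twin : Ix → Ix → Set₁
    Twin i j = Valid i × Valid j × kernel i ≡ kernel j × lab i ≡ lab j

    twin-sym : ∀ {i j} → Twin i j → Twin j i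
    twin-sym (v , v' , e , f) = v' , v , sym e , sym f

    -- Inside a kernel the labels of the endpoints of an edge determine which labels are seen; the only
    -- doubtful case is w ≈ v₂, where both labels coincide and w sees v₁ instead.
    kernel-edge : ∀ {X y₁ y₂ w Z Z'} → ρ X ⋈ y₁ → ρ X ⋈ y₂ → HasLab y₁ Z → HasLab y₂ Z' → y₁ ⟶ y₂ →
      ρ X ⋈ w → HasLab w Z → ¬ ¬ Σ Point λ w' → w ⟶ w' × HasLab w' Z' × ρ X ⋈ w'
    kernel-edge {X} {y₁} {y₂} {w} o₁ o₂ l₁ l₂ r o l = ¬¬-excluded-middle {A = w ~ y₁} >>= λ
      { (yes w~y₁) → let (w' , r' , s) = ~-bisimulation (~-sym w~y₁) r in
          return (w' , r' , lab-~ s l₂ , ⋈-trans o₂ (~⇒⋈ s))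
      ; (no w≁y₁) → reached (⊑-trans (proj₂ o) (proj₁ o₁)) >>= λ (v₁ , s₁ , w⊴v₁) →
          reached (⊑-trans (proj₂ o) (proj₁ o₂)) >>= λ (v₂ , s₂ , w⊴v₂) →
          ⊴-cases w⊴v₂ >>= λ
            { (inj₁ w⟶v₂) → return (v₂ , w⟶v₂ , lab-~ s₂ l₂ , ⋈-trans o₂ (~⇒⋈ s₂))
            ; (inj₂ w≈v₂) → return (v₁ ,
                ⟶-stable (λ n → w≁y₁ (~-trans (≈⇒~ (unless-edge w⊴v₁ n)) (~-sym s₁))) ,
                subst (HasLab v₁) (lab-unique l (lab-~ (~-trans s₂ (≈⇒~ (≈-sym w≈v₂))) l₂)) (lab-~ s₁ l₁) ,
                ⋈-trans o₁ (~⇒⋈ s₁)) } }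

    twin-forth : ∀ {i j i'} → Twin i j → Rel i i' → ¬ ¬ Σ Ix λ j' → Rel j j' × Twin i' j'
    twin-forth {i} {j} {i'} (vi , vj , refl , refl) (_ , vi' , st) =
      inhabited vi >>= λ (y , cl , t) → inhabited vj >>= λ (w , clw , tw) →
      inhabited vi' >>= λ (y' , cl' , t') → go st clw tw cl t cl' t'
      where
      inside : ∀ {w y₁ y₂} → kernel i ≡ kernel i' → Cl (κ (proj₁ j)) w → HasCTyp w (proj₂ j) →
        ρ (kernel i) ⋈ y₁ → HasLab y₁ (lab i) → ρ (kernel i) ⋈ y₂ → HasLab y₂ (lab i') → y₁ ⟶ y₂ →
        ¬ ¬ Σ Ix λ j' → Rel j j' × Twin i' j'
      inside refl clw tw o₁ l₁ o₂ l₂ r =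
        kernel-edge o₁ o₂ l₁ l₂ r (⋈-trans (over vj) (Cl⇒⋈ clw)) (proj₁ tw) >>= λ (w' , r' , l' , o') →
        typ-exists w' >>= λ (s' , ws') →
        rel-inside vj clw tw r' o' (l' , ws') >>= λ (b₀ , rel) →
        return (_ , rel , (vi' , proj₁ (proj₂ rel) , refl , refl))
      go : ∀ {w y y'} → Step i i' → Cl (κ (proj₁ j)) w → HasCTyp w (proj₂ j) →
        Cl (κ (proj₁ i)) y → HasCTyp y (proj₂ i) → Cl (κ (proj₁ i')) y' → HasCTyp y' (proj₂ i') →
        ¬ ¬ Σ Ix λ j' → Rel j j' × Twin i' j'
      go {w} {y} {y'} (within m) clw tw cl t cl' t' = ⊴-cases (⊴-trans (proj₂ cl) (proj₁ cl')) >>= λ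
        { (inj₁ r) → inside refl clw tw (⋈-trans (over vi) (Cl⇒⋈ cl)) (proj₁ t)
                       (⋈-trans (over vi') (Cl⇒⋈ cl')) (proj₁ t') r
        ; (inj₂ e) → [ (λ ≢ → ⊥-elim (≢ (ctyp-unique (ctyp-≈ e t) t')))
                     , (λ dbl → dbl >>= λ (y₁ , y₂ , cl₁ , cl₂ , t₁ , t₂ , r) →
                         inside refl clw tw (⋈-trans (over vi) (Cl⇒⋈ cl₁)) (proj₁ t₁)
                           (⋈-trans (over vi) (Cl⇒⋈ cl₂))
                           (subst (HasLab y₂) (cong proj₁ (ctyp-unique (ctyp-≈ e t) t')) (proj₁ t₂)) r) ]′ m }
      -- `y` reaches a copy `v` of `y'`. If `y ≈ v`, source and target have the same label, and an
      -- edge within that label exists because the cluster is not rigid.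
      go {w} {y} {y'} (across ¬rig d) clw tw cl t cl' t' =
        let o = ⋈-trans (over vi) (Cl⇒⋈ cl)
            o' = ⋈-trans (over vi') (Cl⇒⋈ cl')
        in reached (⊑-trans (proj₂ o) (proj₁ o')) >>= λ (v , y'~v , y⊴v) → ⊴-cases y⊴v >>= λ
        { (inj₁ r) → inside refl clw tw o (proj₁ t) (⋈-trans o' (~⇒⋈ y'~v)) (lab-~ y'~v (proj₁ t')) r
        ; (inj₂ e) → ¬¬-excluded-middle
             {A = Σ Point λ y₁ → Σ Point λ y₂ →
                    y ⋈ y₁ × y ⋈ y₂ × HasLab y₁ (lab i) × HasLab y₂ (lab i) × y₁ ⟶ y₂} >>= λ
             { (no n) → ⊥-elim (¬rig (return (_ , y , cl , proj₁ t ,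
                 λ y₁ y₂ a b c d r → n (y₁ , y₂ , a , b , c , d , r))))
             ; (yes (y₁ , y₂ , a , b , l₁ , l₂ , r)) →
                 inside refl clw tw (⋈-trans o a) l₁ (⋈-trans o b)
                   (subst (HasLab y₂) (lab-unique (proj₁ t) (lab-~ (~-trans y'~v (≈⇒~ (≈-sym e))) (proj₁ t'))) l₂) r } }
      -- `≺` is applied to the cluster of the twin. Domination of `u` passes on to a copy `v` of
      -- `y'` that `u` reaches.
      go {w} {y} {y'} (above p d) clw tw cl t cl' t' =
        p (κ (proj₁ j)) (over vj) >>= λ (u , s , D) →
        reached (⊑-trans (proj₂ (~⇒⋈ s)) (⊑-trans (proj₁ (over vi')) (⊴⇒⊑ (proj₁ cl')))) >>= λ (v , y'~v , u⊴v) →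
        typ-exists v >>= λ (s' , vs) →
        let o = ⋈-trans (over vi') (⋈-trans (Cl⇒⋈ cl') (~⇒⋈ y'~v))
            l = lab-~ y'~v (proj₁ t')
            v' = valid-κ (kernel-lab vi') o (l , vs)
        in return (((kernel i' , (lab i' , s')) , (lab i' , s')) ,
          (vj , v' , above p (dominates-κ o (l , vs) (dominates-⊴ u⊴v D))) ,
          (vi' , v' , refl , refl))

    -- The labels agree, so the type of `i` also occurs in the `~`-class of `w`, where common
    -- formulas are shared.
    twin-∋ : ∀ {i j a} → Common a → a ∈ L → Twin i j → Has (typ i) a → Has (typ j) a
    twin-∋ {i} {j} {a} c a∈ (vi , vj , refl , refl) h = decidable-stable (has? (typ j) a)
      (inhabited vi >>= λ (y , cl , l , t) → inhabited vj >>= λ (w , clw , lw , tw) →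
       lab-transfer l lw t >>= λ (u , w~u , ut) →
       return (∋⇒has a∈ tw (∋-common (~-sym w~u) c (has⇒∋ ut h))))

    -- `x` and `y` have the same label `X`, so both their types occur in the `~`-class of `ρ X`.
    twin-exists : ∀ {x y a b} → x ~ y → a ∈ L → b ∈ L → x ∋ a → y ∋ b →
      ¬ ¬ Σ Ix λ i → Σ Ix λ j → Twin i j × Has (typ i) a × Has (typ j) b
    twin-exists {x} {y} x~y a∈ b∈ x∋a y∋b =
      lab-exists x >>= λ (X , xX) →
      typ-exists x >>= λ (s , xs) →
      typ-exists y >>= λ (s' , ys) →
      let ρX = ρ-lab X x xX in
      lab-transfer xX ρX xs >>= λ (u , ρ~u , us) →
      lab-transfer (lab-~ x~y xX) ρX ys >>= λ (w , ρ~w , ws) →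
      return (_ , _ , (valid-κ ρX (~⇒⋈ ρ~u) (lab-~ ρ~u ρX , us) ,
                       valid-κ ρX (~⇒⋈ ρ~w) (lab-~ ρ~w ρX , ws) , refl , refl) ,
              ∋⇒has a∈ xs x∋a , ∋⇒has b∈ ys y∋b)

-- Generated submodels

record Selection {n} (p : Fin n → Bool) : Set where
  field
    size      : ℕ
    size≤     : size ≤ n
    select    : Fin size → Fin n
    injective : ∀ {a b} → select a ≡ select b → a ≡ b
    sound     : ∀ a → p (select a) ≡ true
    complete  : ∀ i → p i ≡ true → ∃[ a ] select a ≡ i
open Selection

selection : ∀ {n} (p : Fin n → Bool) → Selection p
selection {zero} p = record
  { size = 0 ; size≤ = z≤n ; select = λ () ; injective = λ { {()} } ; sound = λ () ; complete = λ () }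
selection {suc n} p with p zero in eq | selection (p ∘ suc)
... | false | S = record
  { size = size S
  ; size≤ = m≤n⇒m≤1+n (size≤ S)
  ; select = suc ∘ select S
  ; injective = injective S ∘ Finₚ.suc-injective
  ; sound = sound S
  ; complete = λ
    { zero h → contradiction (trans (sym eq) h) λ ()
    ; (suc i) h → let (a , e) = complete S i h in a , cong suc e } }
... | true | S = record
  { size = suc (size S)
  ; size≤ = s≤s (size≤ S)
  ; select = λ { zero → zero ; (suc a) → suc (select S a) }
  ; injective = λ
    { {zero} {zero} _ → refl
    ; {suc a} {suc b} e → cong suc (injective S (Finₚ.suc-injective e)) }
  ; sound = λ { zero → eq ; (suc a) → sound S a }
  ; complete = λ
    { zero _ → zero , refl
    ; (suc i) h → let (a , e) = complete S i h in suc a , cong suc e } }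

record GeneratedSubmodel {n} (M : Model n) (r : Fin n) : Set where
  field
    {size}    : ℕ
    size≤     : size ≤ n
    submodel  : Model size
    embed     : Fin size → Fin n
    R-embed   : ∀ a b → R submodel a b ≡ R M (embed a) (embed b)
    V-embed   : ∀ p a → V submodel p a ≡ V M p (embed a)
    closed    : ∀ a y → embed a R⟨ M ⟩ y → ∃[ b ] embed b ≡ y
    weakly-transitive : WeaklyTransitive submodel
    root      : Fin size
    embed-root : embed root ≡ r
    rooted    : IsRoot submodel root

  R-closed : ∀ {a y} → embed a R⟨ M ⟩ y → ∃[ b ] (embed b ≡ y × a R⟨ submodel ⟩ b)
  R-closed {a} {y} r = let (b , e) = closed a y r in
    b , e , trans (R-embed a b) (trans (cong (R M (embed a)) e) r)

  ⊨-embed : ∀ c a → M ∣ embed a ⊨ c → submodel ∣ a ⊨ c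
  ⊨-embed c a = proj₂ (bisim-invariant (sig c) submodel M (λ a x → embed a ≡ x)
    (λ { a _ refl →
      (λ {p} _ → V-embed p a) ,
      (λ b r → embed b , trans (sym (R-embed a b)) r , refl) ,
      (λ y r → let (b , e , r') = R-closed r in b , r' , e) }) c id refl)

-- By weak transitivity every reachable point is `r` or a successor of `r`, so a decidable one-step
-- condition cuts out the submodel.
generated-submodel : ∀ {n} (M : Model n) → WeaklyTransitive M → ∀ r → GeneratedSubmodel M r
generated-submodel {n} M wt r = record
  { size≤ = size≤ S
  ; submodel = N
  ; embed = f
  ; R-embed = λ _ _ → refl
  ; V-embed = λ _ _ → refl
  ; closed = λ a y s → complete S y
      (dec-true (reachable? y) (step (does-true (reachable? (f a)) (sound S a)) s))
  ; weakly-transitive = λ a b c s t → [ inj₁ ∘ injective S , inj₂ ]′ (wt (f a) (f b) (f c) s t)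
  ; root = root
  ; embed-root = embed-root
  ; rooted = λ a → rooted a (does-true (reachable? (f a)) (sound S a)) }
  where
  reachable? : ∀ i → Dec (r ≡ i ⊎ r R⟨ M ⟩ i)
  reachable? i = (r Fin.≟ i) ⊎-dec (R M r i ≟ᵇ true)
  S = selection (does ∘ reachable?)
  f = select S
  N : Model (size S)
  N = record { R = λ a b → R M (f a) (f b) ; V = λ p a → V M p (f a) }
  step : ∀ {x y} → r ≡ x ⊎ r R⟨ M ⟩ x → x R⟨ M ⟩ y → r ≡ y ⊎ r R⟨ M ⟩ y
  step (inj₁ refl) s = inj₂ s
  step (inj₂ t) s = wt r _ _ t s
  root = proj₁ (complete S r (dec-true (reachable? r) (inj₁ refl)))
  embed-root : f root ≡ r
  embed-root = proj₂ (complete S r (dec-true (reachable? r) (inj₁ refl)))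
  rooted : ∀ a → r ≡ f a ⊎ r R⟨ M ⟩ f a → Star (λ a b → a R⟨ N ⟩ b) root a
  rooted a (inj₁ e) with injective S (trans embed-root e)
  ... | refl = ε
  rooted a (inj₂ s) = trans (cong (λ x → R M x (f a)) embed-root) s ◅ ε

-- Codes of finite relations

relation-code : ∀ {n} {Q : Fin n → Fin n → Set ℓ} → (∀ i j → Dec (Q i j)) →
  Σ (Fin ((2 ^ n) ^ n)) λ c → ∀ i → Codes (finToFun {2 ^ n} {n} c i) (Q i)
relation-code {n = n} {Q} Q? = funToFin f , λ i →
  subst (λ c → Codes c (Q i)) (sym (Finₚ.finToFun-funToFin f i)) (proj₂ (code-of (Q? i)))
  where
  f : Fin n → Fin (2 ^ n)
  f i = proj₁ (code-of (Q? i))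

relation-codes-exist : ∀ {n} (Q : Fin n → Fin n → Set ℓ) →
  ¬ ¬ Σ (Fin ((2 ^ n) ^ n)) λ c → ∀ i → Codes (finToFun {2 ^ n} {n} c i) (Q i)
relation-codes-exist Q = ¬¬-Π (λ i → ¬¬-Π λ j → ¬¬-excluded-middle {A = Q i j}) >>= λ Q? →
  return (relation-code Q?)

-- Subformulas and the size bound

subf-self : ∀ χ → χ ∈ subf χ
subf-self (var _) = here refl
subf-self fls = here refl
subf-self tru = here refl
subf-self (_ ∧' _) = here refl
subf-self (¬' _) = here refl
subf-self (◇ _) = here refl

subf-◇ : ∀ χ {a} → ◇ a ∈ subf χ → a ∈ subf χ
subf-◇ (var _) (here ())
subf-◇ fls (here ())
subf-◇ tru (here ())
subf-◇ (χ ∧' χ') (there i) = there ([ ∈-++⁺ˡ ∘ subf-◇ χ , ∈-++⁺ʳ (subf χ) ∘ subf-◇ χ' ]′ (∈-++⁻ (subf χ) i))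
subf-◇ (¬' χ) (there i) = there (subf-◇ χ i)
subf-◇ (◇ χ) (here refl) = there (subf-self χ)
subf-◇ (◇ χ) (there i) = there (subf-◇ χ i)

sig⇒subf : ∀ χ {p} → p ∈ sig χ → var p ∈ subf χ
sig⇒subf (var _) (here refl) = here refl
sig⇒subf (χ ∧' χ') i = there ([ ∈-++⁺ˡ ∘ sig⇒subf χ , ∈-++⁺ʳ (subf χ) ∘ sig⇒subf χ' ]′ (∈-++⁻ (sig χ) i))
sig⇒subf (¬' χ) i = there (sig⇒subf χ i)
sig⇒subf (◇ χ) i = there (sig⇒subf χ i)

∈-negs⁺ : ∀ {a as} → a ∈ as → ¬' a ∈ negs as
∈-negs⁺ (here refl) = here refl
∈-negs⁺ (there i) = there (∈-negs⁺ i)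

◇∉negs : ∀ as {a} → ¬ (◇ a ∈ negs as)
◇∉negs (_ ∷ as) (there i) = ◇∉negs as i

sub-◇ : ∀ χ {a} → ◇ a ∈ sub χ → a ∈ sub χ
sub-◇ χ i = [ ∈-++⁺ˡ ∘ subf-◇ χ , ⊥-elim ∘ ◇∉negs (subf χ) ]′ (∈-++⁻ (subf χ) i)

2n≤2^n : ∀ n → n + n ≤ 2 ^ n
2n≤2^n zero = z≤n
2n≤2^n (suc zero) = ≤-refl
2n≤2^n (suc (suc n)) = begin
  suc (suc n) + suc (suc n) ≡⟨ cong suc (+-suc (suc n) (suc n)) ⟩
  2 + (suc n + suc n)       ≤⟨ +-mono-≤ (^-monoʳ-≤ 2 (s≤s (z≤n {n}))) (2n≤2^n (suc n)) ⟩
  2 ^ suc n + 2 ^ suc n     ≡⟨ cong (2 ^ suc n +_) (+-identityʳ (2 ^ suc n)) ⟨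
  2 ^ suc (suc n)           ∎
  where open ≤-Reasoning

-- Tight at 2 and 3; the summand 4 is the source of the factor 16 in the size bound.
4n≤4+2^n : ∀ n → 4 * n ≤ 4 + 2 ^ n
4n≤4+2^n zero = z≤n
4n≤4+2^n (suc zero) = s≤s (s≤s (s≤s (s≤s z≤n)))
4n≤4+2^n (suc (suc zero)) = ≤-refl
4n≤4+2^n (suc (suc (suc n))) = begin
  4 * suc (suc (suc n))               ≡⟨ *-suc 4 (suc (suc n)) ⟩
  4 + 4 * suc (suc n)                 ≤⟨ +-mono-≤ (^-monoʳ-≤ 2 (s≤s (s≤s (z≤n {n})))) (4n≤4+2^n (suc (suc n))) ⟩
  2 ^ (2 + n) + (4 + 2 ^ (2 + n))     ≡⟨ +-comm (2 ^ (2 + n)) _ ⟩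
  4 + 2 ^ (2 + n) + 2 ^ (2 + n)       ≡⟨ +-assoc 4 (2 ^ (2 + n)) _ ⟩
  4 + (2 ^ (2 + n) + 2 ^ (2 + n))     ≡⟨ cong (λ m → 4 + (2 ^ (2 + n) + m)) (+-identityʳ _) ⟨
  4 + 2 ^ (3 + n)                     ∎
  where open ≤-Reasoning

-- The search for agreeing models

module Decision (φ ψ : Fm) where

  L : List Fm
  L = deduplicate _≟Fm_ (sub φ ++ sub ψ)

  ∈-L : ∀ {a} → a ∈ sub φ ⊎ a ∈ sub ψ → a ∈ L
  ∈-L = ∈-deduplicate⁺ _≟Fm_ ∘ [ ∈-++⁺ˡ , ∈-++⁺ʳ (sub φ) ]′

  L-closed : ∀ {a} → ◇ a ∈ L → a ∈ L
  L-closed i = [ ∈-L ∘ inj₁ ∘ sub-◇ φ , ∈-L ∘ inj₂ ∘ sub-◇ ψ ]′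
    (∈-++⁻ (sub φ) (∈-deduplicate⁻ _≟Fm_ (sub φ ++ sub ψ) i))

  subfφ⊆L : ∀ {a} → a ∈ subf φ → a ∈ L
  subfφ⊆L = ∈-L ∘ inj₁ ∘ ∈-++⁺ˡ

  subf¬ψ⊆L : ∀ {a} → a ∈ subf (¬' ψ) → a ∈ L
  subf¬ψ⊆L (here refl) = ∈-L (inj₂ (∈-++⁺ʳ (subf ψ) (∈-negs⁺ (subf-self ψ))))
  subf¬ψ⊆L (there i) = ∈-L (inj₂ (∈-++⁺ˡ i))

  open Agreement φ ψ
  open Filtration φ ψ L L-closed

  ϱ : List ℕ
  ϱ = φ ∩sig ψ

  nLab nTyp n : ℕ
  nLab = 2 ^ (2 ^ length L)
  nTyp = 2 ^ length L
  n = (nLab * (nLab * nTyp)) * (nLab * nTyp)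

  index : Fin n ↔ Ix
  index = ↔-trans Finₚ.*↔× (↔-trans Finₚ.*↔× (↔-refl ×-↔ Finₚ.*↔×) ×-↔ Finₚ.*↔×)

  ix : Fin n → Ix
  ix = Inverse.to index

  ix⁻¹ : Ix → Fin n
  ix⁻¹ = Inverse.from index

  ix-ix⁻¹ : ∀ i → ix (ix⁻¹ i) ≡ i
  ix-ix⁻¹ = Inverse.strictlyInverseˡ index

  ix-injective : ∀ {i j} → ix i ≡ ix j → i ≡ j
  ix-injective {i} {j} e = trans (sym (Inverse.strictlyInverseʳ index i))
    (trans (cong ix⁻¹ e) (Inverse.strictlyInverseʳ index j))

  RelCode : Set
  RelCode = Fin ((2 ^ n) ^ n)

  BitAt : RelCode → Fin n → Fin n → Set
  BitAt c i j = Bit {n} (finToFun {2 ^ n} {n} c i) j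

  bitAt? : ∀ c i j → Dec (BitAt c i j)
  bitAt? c i j = bit? {n} (finToFun {2 ^ n} {n} c i) j

  -- The valuation is read off the types and only the relation varies, so there are finitely many
  -- candidates.
  model : RelCode → Model n
  model c = record
    { R = λ i j → does (bitAt? c i j)
    ; V = λ p i → does (has? (typ (ix i)) (var p)) }

  Agreeing : RelCode → RelCode → Fin n → Fin n → Set
  Agreeing c b i j =
    WeaklyTransitive (model c) × (model c ∣ i ⊨ φ) × (model c ∣ j ⊨ ¬' ψ) ×
    IsBisim ϱ (model c) (model c) (BitAt b) × BitAt b i j

  edge? : ∀ c i j → Dec (i R⟨ model c ⟩ j)
  edge? c i j = R (model c) i j ≟ᵇ true

  weaklyTransitive? : ∀ c → Dec (WeaklyTransitive (model c))
  weaklyTransitive? c = Finₚ.all? λ i → Finₚ.all? λ j → Finₚ.all? λ k →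
    edge? c i j →-dec (edge? c j k →-dec ((i Fin.≟ k) ⊎-dec edge? c i k))

  bisim? : ∀ c b → Dec (IsBisim ϱ (model c) (model c) (BitAt b))
  bisim? c b = Finₚ.all? λ i → Finₚ.all? λ j → bitAt? b i j →-dec
    (map′ (λ al {p} → All.lookup al) (λ f → All.tabulate f)
       (All.all? (λ p → V (model c) p i ≟ᵇ V (model c) p j) ϱ) ×-dec
     (Finₚ.all? (λ k → edge? c i k →-dec Finₚ.any? λ l → edge? c j l ×-dec bitAt? b k l) ×-dec
      Finₚ.all? (λ l → edge? c j l →-dec Finₚ.any? λ k → edge? c i k ×-dec bitAt? b k l)))

  -- This is what removes the double negation from the whole construction.
  agreeing? : Dec (∃[ c ] ∃[ b ] ∃[ i ] ∃[ j ] Agreeing c b i j)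
  agreeing? = Finₚ.any? λ c → Finₚ.any? λ b → Finₚ.any? λ i → Finₚ.any? λ j →
    weaklyTransitive? c ×-dec (⊨-dec (model c) i φ ×-dec (⊨-dec (model c) j (¬' ψ) ×-dec
      (bisim? c b ×-dec bitAt? b i j)))

  -- One model serves both sides: the witnesses are its submodels generated by `i` and by `j`, with
  -- the bisimulation restricted to them.
  agreeing⇒witness : ∀ {bound} → n ≤ bound →
    (∃[ c ] ∃[ b ] ∃[ i ] ∃[ j ] Agreeing c b i j) → Witness bound φ ψ
  agreeing⇒witness n≤ (c , b , i , j , wt , i⊨φ , j⊨¬ψ , bis , bij) =
    _ , _ , M₁.submodel , M₂.submodel , M₁.root , M₂.root ,
    M₁.weakly-transitive , M₂.weakly-transitive , M₁.rooted , M₂.rooted ,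
    M₁.⊨-embed φ M₁.root (subst (λ x → model c ∣ x ⊨ φ) (sym M₁.embed-root) i⊨φ) ,
    M₂.⊨-embed (¬' ψ) M₂.root (subst (λ x → model c ∣ x ⊨ ¬' ψ) (sym M₂.embed-root) j⊨¬ψ) ,
    ((λ x y → BitAt b (M₁.embed x) (M₂.embed y)) ,
     (λ x y h → let (vars , forth , back) = bis _ _ h in
       (λ {p} p∈ → trans (M₁.V-embed p x) (trans (vars p∈) (sym (M₂.V-embed p y)))) ,
       (λ x' r → let (_ , r' , h') = forth _ (trans (sym (M₁.R-embed x x')) r)
                     (y' , e , s) = M₂.R-closed r'
                 in y' , s , subst (BitAt b _) (sym e) h') ,
       (λ y' r → let (_ , r' , h') = back _ (trans (sym (M₂.R-embed y y')) r)
                     (x' , e , s) = M₁.R-closed r'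
                 in x' , s , subst (λ z → BitAt b z _) (sym e) h')) ,
     subst (λ z → BitAt b z _) (sym M₁.embed-root) (subst (BitAt b i) (sym M₂.embed-root) bij)) ,
    ≤-trans M₁.size≤ n≤ , ≤-trans M₂.size≤ n≤
    where
    module M₁ = GeneratedSubmodel (generated-submodel (model c) wt i)
    module M₂ = GeneratedSubmodel (generated-submodel (model c) wt j)

  -- Truth and bisimulation in the coded model

  module Realise
    (ρ : Lab → Point)
    (ρ-lab : ∀ X x → HasLab x X → HasLab (ρ X) X)
    (κ : Lab × CTyp → Point)
    (κ-spec : ∀ i y → ρ (proj₁ i) ⋈ y × HasCTyp y (proj₂ i) →
              ρ (proj₁ i) ⋈ κ i × HasCTyp (κ i) (proj₂ i))
    where

    open Quotient ρ ρ-lab κ κ-spec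

    module Coded
      (c b : RelCode)
      (c-codes : ∀ i → Codes {n = n} (finToFun c i) (λ j → Rel (ix i) (ix j)))
      (b-codes : ∀ i → Codes {n = n} (finToFun b i) (λ j → Twin (ix i) (ix j)))
      where

      edge⇒rel : ∀ {i j} → i R⟨ model c ⟩ j → Rel (ix i) (ix j)
      edge⇒rel {i} {j} r = Codes.bit⇒ (c-codes i) (does-true (bitAt? c i j) r)

      rel⇒edge : ∀ {i j} → Rel (ix i) (ix j) → i R⟨ model c ⟩ j
      rel⇒edge {i} {j} r = dec-true (bitAt? c i j) (Codes.⇒bit (c-codes i) r)

      rel⇒edge⁻¹ : ∀ {i j} → Rel (ix i) j → i R⟨ model c ⟩ ix⁻¹ j
      rel⇒edge⁻¹ {i} {j} r = rel⇒edge (subst (Rel (ix i)) (sym (ix-ix⁻¹ j)) r)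

      model-weakly-transitive : WeaklyTransitive (model c)
      model-weakly-transitive i j k r s with i Fin.≟ k
      ... | yes e = inj₁ e
      ... | no ≢ = inj₂ (rel⇒edge (rel-weakly-transitive (edge⇒rel r) (edge⇒rel s) (≢ ∘ ix-injective)))

      -- Restricted to valid indices, whose types are realised by points; edges join only such
      -- indices, so the induction over diamonds stays among them.
      truth : ∀ a → (∀ {d} → d ∈ subf a → d ∈ L) → ∀ {i} → Valid (ix i) →
        (model c ∣ i ⊨ a → Has (typ (ix i)) a) × (Has (typ (ix i)) a → model c ∣ i ⊨ a)
      truth (var p) ⊆L v = does-true (has? _ _) , dec-true (has? _ _)
      truth fls ⊆L v = (λ ()) , ¬has-fls v
      truth tru ⊆L v =
        (λ _ → has-¬¬ v (⊆L (here refl)) λ {y} _ → return (∋-thm y ⊢-tru)) , λ _ → tt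
      truth (a ∧' d) ⊆L v =
        let a⊆L : ∀ {e} → e ∈ subf a → e ∈ L
            a⊆L = λ e∈ → ⊆L (there (∈-++⁺ˡ e∈))
            d⊆L : ∀ {e} → e ∈ subf d → e ∈ L
            d⊆L = λ e∈ → ⊆L (there (∈-++⁺ʳ (subf a) e∈))
            (f , g) = truth a a⊆L v
            (f' , g') = truth d d⊆L v
        in (λ (p , q) → has-¬¬ v (⊆L (here refl)) λ {y} t →
             return (∋-∧⁺ y (has⇒∋ t (f p)) (has⇒∋ t (f' q)))) ,
           (λ h → g (has-¬¬ v (a⊆L (subf-self a)) λ {y} t → return (∋-∧ˡ y (has⇒∋ t h))) ,
                  g' (has-¬¬ v (d⊆L (subf-self d)) λ {y} t → return (∋-∧ʳ y {a} (has⇒∋ t h))))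
      truth (¬' a) ⊆L v =
        let (f , g) = truth a (⊆L ∘ there) v in
        (λ n → has-¬ v (⊆L (there (subf-self a))) (⊆L (here refl)) (n ∘ g)) ,
        (λ n h → has-consistent v (f h) n)
      truth (◇ a) ⊆L {i} v =
        (λ (j , r , h) → let rel = edge⇒rel r in
          rel-◇⁺ rel (⊆L (here refl)) (proj₁ (truth a (⊆L ∘ there) (proj₁ (proj₂ rel))) h)) ,
        (λ h → decidable-stable (⊨-dec (model c) i (◇ a))
          (rel-◇⁻ v (⊆L (here refl)) h >>= λ (j , rel , h') → return (ix⁻¹ j , rel⇒edge⁻¹ rel ,
            proj₂ (truth a (⊆L ∘ there) (subst Valid (sym (ix-ix⁻¹ j)) (proj₁ (proj₂ rel))))
              (subst (λ k → Has (typ k) a) (sym (ix-ix⁻¹ j)) h'))))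

      forth : ∀ {i j i'} → Twin (ix i) (ix j) → i R⟨ model c ⟩ i' →
        ¬ ¬ (∃[ j' ] (j R⟨ model c ⟩ j' × Twin (ix i') (ix j')))
      forth t r = twin-forth t (edge⇒rel r) >>= λ (j' , rel , t') →
        return (ix⁻¹ j' , rel⇒edge⁻¹ rel , subst (Twin _) (sym (ix-ix⁻¹ j')) t')

      model-bisim : IsBisim ϱ (model c) (model c) (BitAt b)
      model-bisim i j h =
        (λ p∈ → let (p∈φ , p∈ψ) = ∈-filter⁻ (_∈? sig ψ) {xs = sig φ} p∈
                    common = λ { _ (here refl) → p∈φ , p∈ψ }
                    p∈L = subfφ⊆L (sig⇒subf φ p∈φ)
                in does-⇔ (mk⇔ (twin-∋ common p∈L t) (twin-∋ common p∈L (twin-sym t))) (has? _ _) (has? _ _)) ,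
        (λ i' r → decidable-stable (Finₚ.any? λ j' → edge? c j j' ×-dec bitAt? b i' j')
          (forth t r >>= λ (j' , r' , t') → return (j' , r' , Codes.⇒bit (b-codes i') t'))) ,
        (λ j' r → decidable-stable (Finₚ.any? λ i' → edge? c i i' ×-dec bitAt? b i' j')
          (forth (twin-sym t) r >>= λ (i' , r' , t') →
            return (i' , r' , Codes.⇒bit (b-codes i') (twin-sym t'))))
        where
        t : Twin (ix i) (ix j)
        t = Codes.bit⇒ (b-codes i) h

      agreeing : ∀ {i j} → Twin i j → Has (typ i) φ → Has (typ j) (¬' ψ) → Agreeing c b (ix⁻¹ i) (ix⁻¹ j)
      agreeing {i} {j} t h h' = model-weakly-transitive ,
        proj₂ (truth φ subfφ⊆L (proj₁ t')) (subst (λ k → Has (typ k) φ) (sym (ix-ix⁻¹ i)) h) ,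
        proj₂ (truth (¬' ψ) subf¬ψ⊆L (proj₁ (proj₂ t')))
          (subst (λ k → Has (typ k) (¬' ψ)) (sym (ix-ix⁻¹ j)) h') ,
        model-bisim , Codes.⇒bit (b-codes (ix⁻¹ i)) t'
        where
        t' : Twin (ix (ix⁻¹ i)) (ix (ix⁻¹ j))
        t' = subst (λ k → Twin k _) (sym (ix-ix⁻¹ i)) (subst (Twin i) (sym (ix-ix⁻¹ j)) t)

  ¬interpolant⇒agreeing : ¬ HasInterpolant φ ψ → ∃[ c ] ∃[ b ] ∃[ i ] ∃[ j ] Agreeing c b i j
  ¬interpolant⇒agreeing ¬ι = decidable-stable agreeing? (
    let (x , y , x∋φ , y∋¬ψ , x~y) = agreeing-points ¬ι in
    ε-choice {P = λ X x → HasLab x X} ↔-refl x >>= λ (ρ , ρ-lab) →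
    ε-choice {P = λ i y → ρ (proj₁ i) ⋈ y × HasCTyp y (proj₂ i)}
      (↔-trans Finₚ.*↔× (↔-refl ×-↔ Finₚ.*↔×)) x >>= λ (κ , κ-spec) →
    let open Quotient ρ ρ-lab κ κ-spec in
    relation-codes-exist (λ i j → Rel (ix i) (ix j)) >>= λ (c , c-codes) →
    relation-codes-exist (λ i j → Twin (ix i) (ix j)) >>= λ (b , b-codes) →
    twin-exists x~y (subfφ⊆L (subf-self φ)) (subf¬ψ⊆L (here refl)) x∋φ y∋¬ψ >>= λ (i , j , t , h , h') →
    return (c , b , ix⁻¹ i , ix⁻¹ j , Realise.Coded.agreeing ρ ρ-lab κ κ-spec c b c-codes b-codes t h h'))

  n≤16*tripleExp : n ≤ 16 * tripleExp (∣sub∪sub∣ φ ψ)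
  n≤16*tripleExp = begin
    2 ^ m * (2 ^ m * 2 ^ k) * (2 ^ m * 2 ^ k) ≡⟨ cong (λ u → 2 ^ m * u * u) (sym (^-distribˡ-+-* 2 m k)) ⟩
    2 ^ m * 2 ^ (m + k) * 2 ^ (m + k)         ≡⟨ cong (_* 2 ^ (m + k)) (sym (^-distribˡ-+-* 2 m (m + k))) ⟩
    2 ^ (m + (m + k)) * 2 ^ (m + k)           ≡⟨ sym (^-distribˡ-+-* 2 (m + (m + k)) (m + k)) ⟩
    2 ^ (m + (m + k) + (m + k))               ≤⟨ ^-monoʳ-≤ 2 exponent ⟩
    2 ^ (4 + 2 ^ m)                           ≡⟨ ^-distribˡ-+-* 2 4 (2 ^ m) ⟩
    16 * 2 ^ (2 ^ m)                          ∎
    where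
    open ≤-Reasoning
    k = length L
    m = 2 ^ k
    exponent : m + (m + k) + (m + k) ≤ 4 + 2 ^ m
    exponent = begin
      m + (m + k) + (m + k)   ≡⟨ rearrange m k ⟩
      m + m + m + (k + k)     ≤⟨ +-monoʳ-≤ (m + m + m) (2n≤2^n k) ⟩
      m + m + m + m           ≡⟨ fourfold m ⟩
      4 * m                   ≤⟨ 4n≤4+2^n m ⟩
      4 + 2 ^ m               ∎
      where
      rearrange : ∀ m k → m + (m + k) + (m + k) ≡ m + m + m + (k + k)
      rearrange = solve-∀
      fourfold : ∀ m → m + m + m + m ≡ 4 * m
      fourfold = solve-∀

theorem3p10 : Σ ℕ λ c → ∀ (φ ψ : Fm) →
    (¬ HasInterpolant φ ψ) ⇔ Witness (c * tripleExp (∣sub∪sub∣ φ ψ)) φ ψ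
theorem3p10 = 16 , λ φ ψ → let open Decision φ ψ in
  mk⇔ (agreeing⇒witness n≤16*tripleExp ∘ ¬interpolant⇒agreeing) witness⇒¬interpolant
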